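{- There is a streaming algorithm for triangle counting in max-degree $d$ graphs of length-$L$ turnstile streams using $O\left(\frac{d^3L^2}{\varepsilon^2T^2}\log n\right)$ bits of space. That is, given parameters $n,d,L,T$ and $\varepsilon\in(0,1)$, there is a streaming algorithm using $O\left(\frac{d^3L^2}{\varepsilon^2T^2}\log n\right)$ bits which, for every length-$L$ strict turnstile stream whose final state is (the indicator vector of) a graph with maximum degree at most $d$ and at least $T$ triangles, outputs with probability at least $2/3$ an estimate of the number of triangles of the final graph that is correct to within a multiplicative factor $1\pm\varepsilon$.
   Context: The stream is a sequence of $L$ updates $\sigma_1,\dots,\sigma_L$, each of the form $(e,\Delta)$ with $e\in E(K_n)$ (an edge on the vertex set $[n]$) and $\Delta\in\mathbb{Z}$. The state at time $t$ is the vector $x^{(t)}\in\mathbb{Z}^{E(K_n)}$ whose coordinate $x^{(t)}_e$ is the sum of the values $\Delta$ over all updates to $e$ among $\sigma_1,\dots,\sigma_t$. Strict turnstile means $x^{(t)}_e\ge0$ for all $e$ and $t$. The intermediate states may be arbitrary multigraphs, with no degree bound; the integers occurring (update values and multiplicities) are of size $\mathrm{poly}(n)$, so that each is representable in $O(\log n)$ bits. The final state $x=x^{(L)}$ is in $\{0,1\}^{E(K_n)}$, and the final graph $G$ is the graph on $[n]$ with edge set $\{e:x_e=1\}$; it has maximum degree at most $d$. Formally, the data stream problem uses a known lower bound $T$ on the number of triangles: any output is acceptable when the input is not valid or when the number of triangles of the final graph is less than $T$; otherwise, the acceptable outputs are those in $[(1-\varepsilon)T_G,(1+\varepsilon)T_G]$,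 where $T_G$ is the number of triangles of $G$. A streaming algorithm may be randomized; its space is the number of bits needed to represent the states it reaches. The constant in $O(\cdot)$ is absolute (depending only on the polynomial bound on the integers). -}

module Defs where

open import Data.Nat.Base as ℕ using (ℕ; suc; _^_; NonZero)
open import Data.Nat.Logarithm using (⌊log₂_⌋)
open import Data.Integer.Base as ℤ using (ℤ; 0ℤ; 1ℤ)
open import Data.Integer.Properties as ℤ using ()
open import Data.Rational.Base as ℚ using (ℚ; 0ℚ; 1ℚ)
open import Data.Fin.Base as Fin using (Fin)
open import Data.Fin.Properties as Fin using ()
open import Data.Bool.Base using (Bool)
open import Data.List.Base as List
  using (List; length; filter; map; foldr; take; allFin; cartesianProduct)
open import Data.List.Relation.Unary.All using (All)
open import Data.List.Relation.Unary.Unique.Propositional using (Unique)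
open import Data.Vec.Base using (Vec; []; _∷_; toList)
open import Data.Product.Base using (Σ-syntax; ∃-syntax; _×_; _,_; proj₁; proj₂)
open import Data.Sum.Base using (_⊎_)
open import Level using (0ℓ)
open import Relation.Binary.Definitions using (DecidableEquality)
open import Relation.Binary.PropositionalEquality using (_≡_; refl)
open import Relation.Nullary.Decidable using (Dec; yes; no; map′; _×-dec_; _⊎-dec_)
open import Relation.Nullary.Negation using (¬_)
open import Relation.Unary using (Pred; _∈_)

fromℕ : ℕ → ℚ
fromℕ m = ℤ.+ m ℚ./ 1

-- Dedekind reals.

record ℝ : Set₁ where
  field
    lower upper     : Pred ℚ 0ℓ
    lower-inhabited : ∃[ q ] q ∈ lower
    upper-inhabited : ∃[ q ] q ∈ upper
    lower-closed    : ∀ {q r} → q ℚ.< r → r ∈ lower → q ∈ lower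
    upper-closed    : ∀ {q r} → q ℚ.< r → q ∈ upper → r ∈ upper
    lower-open      : ∀ {q} → q ∈ lower → ∃[ r ] q ℚ.< r × r ∈ lower
    upper-open      : ∀ {r} → r ∈ upper → ∃[ q ] q ℚ.< r × q ∈ upper
    disjoint        : ∀ {q} → ¬ (q ∈ lower × q ∈ upper)
    located         : ∀ {q r} → q ℚ.< r → q ∈ lower ⊎ r ∈ upper

infix 4 _<ℝ_ _ℝ<_

_<ℝ_ : ℚ → ℝ → Set
q <ℝ x = q ∈ ℝ.lower x

_ℝ<_ : ℝ → ℚ → Set
x ℝ< q = q ∈ ℝ.upper x

-- E(Kₙ): an unordered pair of distinct vertices is listed in increasing order.

record Edge (n : ℕ) : Set where
  constructor edge
  field
    lo hi  : Fin n
    .lo<hi : lo Fin.< hi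

infix 4 _≟ᴱ_

_≟ᴱ_ : ∀ {n} → DecidableEquality (Edge n)
edge a b _ ≟ᴱ edge c d _ = map′
  (λ { (refl , refl) → refl }) (λ { refl → refl , refl })
  ((a Fin.≟ c) ×-dec (b Fin.≟ d))

Update : ℕ → Set
Update n = Edge n × ℤ

Stream : ℕ → ℕ → Set
Stream n L = Vec (Update n) L

State : ℕ → Set
State n = Edge n → ℤ

stateAt : ∀ {n L} → Stream n L → ℕ → State n
stateAt σ t e =
  foldr ℤ._+_ 0ℤ
    (map proj₂ (filter (λ u → proj₁ u ≟ᴱ e) (take t (toList σ))))

final : ∀ {n L} → Stream n L → State n
final {L = L} σ = stateAt σ L

-- The graph on Fin n with edge set { e | x e ≡ 1 }.

module _ {n : ℕ} (x : State n) where

  EdgeFrom : Fin n → Fin n → Set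
  EdgeFrom u v = Σ[ u<v ∈ u Fin.< v ] x (edge u v u<v) ≡ 1ℤ

  Adj : Fin n → Fin n → Set
  Adj u v = EdgeFrom u v ⊎ EdgeFrom v u

  Triangle : Fin n × Fin n × Fin n → Set
  Triangle (u , v , w) =
    (u Fin.< v × v Fin.< w) × (Adj u v × Adj v w × Adj u w)

  edgeFrom? : ∀ u v → Dec (EdgeFrom u v)
  edgeFrom? u v with u Fin.<? v
  ... | yes u<v = map′ (u<v ,_) proj₂ (x (edge u v u<v) ℤ.≟ 1ℤ)
  ... | no  u≮v = no λ p → u≮v (proj₁ p)

  adj? : ∀ u v → Dec (Adj u v)
  adj? u v = edgeFrom? u v ⊎-dec edgeFrom? v u

  triangle? : ∀ t → Dec (Triangle t)
  triangle? (u , v , w) =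
    ((u Fin.<? v) ×-dec (v Fin.<? w)) ×-dec
    (adj? u v ×-dec (adj? v w ×-dec adj? u w))

  degree : Fin n → ℕ
  degree u = length (filter (adj? u) (allFin n))

  #triangles : ℕ
  #triangles = length (filter triangle?
    (cartesianProduct (allFin n) (cartesianProduct (allFin n) (allFin n))))

-- All integers occurring are at most n ^ c in absolute value. As there are
-- no edges for n ≤ 1, every polynomial bound is of this form for some c.

record Valid (c n d L T : ℕ) (σ : Stream n L) : Set where
  field
    updates-bounded : All (λ u → ℤ.∣ proj₂ u ∣ ℕ.≤ n ^ c) (toList σ)
    states-bounded  : ∀ t → t ℕ.≤ L → ∀ e → ℤ.∣ stateAt σ t e ∣ ℕ.≤ n ^ c
    strict          : ∀ t → t ℕ.≤ L → ∀ e → 0ℤ ℤ.≤ stateAt σ t e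
    final-0/1       : ∀ e → final σ e ≡ 0ℤ ⊎ final σ e ≡ 1ℤ
    max-degree      : ∀ v → degree (final σ) v ℕ.≤ d
    many-triangles  : T ℕ.≤ #triangles (final σ)

-- Fresh uniform randomness is drawn for the initial state and for every
-- update. Whatever is to be remembered, including earlier randomness and the
-- current time, has to be part of the memory.

record StreamingAlgorithm (n : ℕ) : Set₁ where
  field
    Memory      : Set
    coins       : ℕ
    {{coins≢0}} : NonZero coins
    init        : Fin coins → Memory
    step        : Fin coins → Update n → Memory → Memory
    output      : Memory → ℚ

  run : ∀ {L} → Vec (Fin coins) L → Stream n L → Memory → Memory
  run []      []      m = m
  run (r ∷ ω) (u ∷ σ) m = run ω σ (step r u m)

  estimate : ∀ {L} → Stream n L → Vec (Fin coins) (suc L) → ℚ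
  estimate σ (r ∷ ω) = output (run ω σ (init r))

  data Reachable : Memory → Set where
    start : ∀ r → Reachable (init r)
    next  : ∀ r u {m} → Reachable m → Reachable (step r u m)

  UsesBits : ℕ → Set
  UsesBits s = Σ[ encode ∈ (Memory → Vec Bool s) ]
    (∀ {m m′} → Reachable m → Reachable m′ → encode m ≡ encode m′ → m ≡ m′)

-- A uniformly random ω : Vec (Fin k) l satisfies E with probability at least
-- a / b. The event need not be decidable, so this is witnessed by a list of
-- distinct favourable outcomes.

ProbAtLeast : (a b : ℕ) {k l : ℕ} → Pred (Vec (Fin k) l) 0ℓ → Set
ProbAtLeast a b {k} {l} E =
  Σ[ ωs ∈ List (Vec (Fin k) l) ]
    Unique ωs × All E ωs × a ℕ.* k ^ l ℕ.≤ b ℕ.* length ωs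

-- X ∈ [(1 - ε) m , (1 + ε) m], for ε the infimum of its upper cut.

Approximates : ℝ → ℕ → ℚ → Set
Approximates ε m X = ∀ q → ε ℝ< q →
  (1ℚ ℚ.- q) ℚ.* fromℕ m ℚ.≤ X × X ℚ.≤ (1ℚ ℚ.+ q) ℚ.* fromℕ m

-- s ≤ C · (d³ L² / (ε² T²)) · log n with the denominator cleared, for ε > 0
-- the supremum of the positive rationals below it. Rounding log₂ n down
-- only affects the constant: for n ≥ 2 the two are within a factor 2, and for
-- n ≤ 1 no stream is valid when T > 0.

SpaceBound : (C n d L T : ℕ) → ℝ → ℕ → Set
SpaceBound C n d L T ε s = ∀ q → 0ℚ ℚ.< q → q <ℝ ε →
  fromℕ s ℚ.* (q ℚ.* q ℚ.* fromℕ (T ^ 2))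
    ℚ.≤ fromℕ (C ℕ.* (d ^ 3 ℕ.* L ^ 2) ℕ.* ⌊log₂ n ⌋)

{-# OPTIONS --safe #-}
module Submission where

-- Call the last update at which the multiplicity of an edge of the final
-- graph leaves 0 the birth of that edge. An algorithm that starts watching an
-- edge at some update can tell whether this update was its birth: the sum of
-- the changes seen must stay positive and end in 1. It can likewise tell
-- whether the birth is yet to come: reflected at 0, the sum must end in 1.
-- Hence every triangle is found from exactly one pair of updates, the births
-- i < j of the first two of its edges uv and vw.
--
-- One copy of the sampler picks i uniformly, an orientation uv of its edge,
-- and then j by reservoir sampling among the m later updates at v. It outputs
-- 2Lm if i and j are births and uw is born after j, and 0 otherwise. This is
-- unbiased; each final edge has one birth, m is at most the number of updates
-- at v, and degrees are at most d, so the second moment is at most 4L²d².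
-- By Chebyshev O(L²d²/(ε²T²)) independent copies suffice. Each takes
-- O(log n + log L) bits, which is O(log n) if L < T² ≤ n⁶. If L ≥ T², the whole
-- stream can be stored.

-- A sampler that enters in the middle of the stream does not know the current multiplicity x of its
-- edge. A tracker started at 0 never exceeds x. If x was positive before the first update seen, the
-- absorbing tracker either dies at 0 or stays strictly below x; as x ends in 0 or 1, the tracker
-- then ends in 0. So strictness and the final 0/1 state are what make births recognisable.
--
-- Drawing j among the updates at v, and not among all L, is what keeps the second moment small: a
-- birth of uv is charged m·d, there are at most d of them at v, and the counts of updates at v sum
-- to 2L over all vertices.
--
-- The number of copies has to be rounded up, which costs only a constant factor if T² ≤ 4L²d². A
-- valid stream guarantees this, since the squared mean of the estimate is at most its second
-- moment; without valid streams there is nothing to prove.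
--
-- Space is measured over all reachable memories, including those of invalid or overlong streams.
-- Hence all counters are truncated, and it must be shown that truncation never acts on valid
-- streams.
--
-- Probabilities are counts of coin sequences, so moments are relations in ℕ multiplied by the
-- number of outcomes.

open import Defs
open import Data.Nat.Properties
open import Algebra.Properties.Semiring.Sum +-*-semiring
  using (sum; sum-syntax; sum-cong-≗; ∑-distrib-+; ∑-comm; *-distribˡ-sum; *-distribʳ-sum)
open import Data.Bool.Base using (Bool; true; false; if_then_else_)
open import Data.Bool.Properties using (∨-comm)
open import Data.Empty using (⊥-elim-irr)
open import Data.Fin.Base as Fin using (Fin; zero; suc; toℕ; _↑ˡ_; _↑ʳ_; remQuot)
open import Data.Fin.Properties as Fin using (splitAt-↑ˡ; splitAt-↑ʳ; toℕ-↑ˡ; toℕ-↑ʳ)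
open import Data.Integer.Base as ℤ using (ℤ; -[1+_]; 0ℤ; 1ℤ)
import Data.Integer.Properties as ℤ
open import Data.List.Base as List
  using (List; []; _∷_; _++_; length; filter; map; tabulate; allFin; cartesianProduct; cartesianProductWith; take; foldr)
open import Data.List.Properties
  using (length-++; length-map; length-filter; length-tabulate; map-cong; filter-++;
         filter-accept; filter-reject; take-map; take-all; ++-assoc; ++-identityʳ)
open import Data.List.Relation.Unary.All as All using (All; []; _∷_)
import Data.List.Relation.Unary.All.Properties as All
open import Data.List.Relation.Unary.AllPairs as AllPairs using ()
open import Data.List.Relation.Unary.Unique.Propositional using (Unique)
open import Data.List.Relation.Unary.Unique.Propositional.Properties using (cartesianProductWith⁺; allFin⁺; filter⁺)
open import Data.Maybe.Base using (Maybe; just; nothing)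
open import Data.Nat.Base
open import Data.Nat.Divisibility using (_∣_; divides; ∣-trans; m∣m*n; n∣m*n; m≤n⇒m!∣n!)
open import Data.Nat.DivMod
open import Data.Nat.Logarithm using (⌊log₂_⌋; ⌊log₂⌋-mono-≤; ⌊log₂[2^n]⌋≡n)
open import Data.Nat.Tactic.RingSolver using (solve-∀)
open import Data.Product.Base using (Σ-syntax; ∃-syntax; _×_; _,_; proj₁; proj₂)
open import Data.Rational.Base as ℚ using (ℚ; 0ℚ; 1ℚ; toℚᵘ)
import Data.Rational.Properties as ℚ
open import Data.Rational.Solver using (module +-*-Solver)
open import Data.Rational.Unnormalised.Base as ℚᵘ using (mkℚᵘ; *≡*; *≤*)
import Data.Rational.Unnormalised.Properties as ℚᵘ
open import Data.Sum.Base using (_⊎_; inj₁; inj₂; [_,_])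
open import Data.Unit.Base using (⊤; tt)
open import Data.Vec.Base as Vec using (Vec; []; _∷_; toList)
open import Data.Vec.Properties using (++-injective; ∷-injective; length-toList)
open import Function.Base using (_∘_; id)
open import Relation.Binary.Definitions using (tri<; tri≈; tri>)
open import Relation.Binary.PropositionalEquality hiding ([_])
open import Relation.Nullary.Decidable using (Dec; yes; no; does; dec-false; dec-true; _×-dec_; _⊎-dec_)
open import Relation.Nullary.Negation using (¬_; contradiction)
open import Relation.Unary using (Decidable)

-- Counting over independent runs

^-distrib-* : ∀ a b k → (a * b) ^ k ≡ a ^ k * b ^ k
^-distrib-* a b zero    = refl
^-distrib-* a b (suc k) = trans (cong (a * b *_) (^-distrib-* a b k))
  ([m*n]*[o*p]≡[m*o]*[n*p] a b (a ^ k) (b ^ k))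

∑-const : ∀ n c → ∑[ _ < n ] c ≡ n * c
∑-const zero    c = refl
∑-const (suc n) c = cong (c +_) (∑-const n c)

∑-mono : ∀ {n} {f g : Fin n → ℕ} → (∀ i → f i ≤ g i) → sum f ≤ sum g
∑-mono {zero}  f≤g = z≤n
∑-mono {suc n} f≤g = +-mono-≤ (f≤g zero) (∑-mono (f≤g ∘ suc))

∑-zero : ∀ {n} {f : Fin n → ℕ} → (∀ i → f i ≡ 0) → sum f ≡ 0
∑-zero {zero}  f≡0 = refl
∑-zero {suc n} f≡0 = cong₂ _+_ (f≡0 zero) (∑-zero (f≡0 ∘ suc))

∑-single : ∀ {n} (f : Fin n → ℕ) j → (∀ i → i ≢ j → f i ≡ 0) → sum f ≡ f j
∑-single f zero    f≡0 =
  trans (cong (f zero +_) (∑-zero (λ i → f≡0 (suc i) λ ()))) (+-identityʳ _)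
∑-single f (suc j) f≡0 =
  cong₂ _+_ (f≡0 zero λ ()) (∑-single (f ∘ suc) j λ i i≢j → f≡0 (suc i) (i≢j ∘ Fin.suc-injective))

∑-++ : ∀ m {n} (f : Fin (m + n) → ℕ) →
       sum f ≡ ∑[ i < m ] f (i ↑ˡ n) + ∑[ i < n ] f (m ↑ʳ i)
∑-++ zero    f = refl
∑-++ (suc m) f = trans (cong (f zero +_) (∑-++ m (f ∘ suc))) (sym (+-assoc (f zero) _ _))

∑-remQuot : ∀ m n (f : Fin m × Fin n → ℕ) →
            ∑[ r < m * n ] f (remQuot n r) ≡ ∑[ i < m ] ∑[ j < n ] f (i , j)
∑-remQuot zero    n f = refl
∑-remQuot (suc m) n f = trans (∑-++ n _) (cong₂ _+_
  (sum-cong-≗ λ j → cong f (eqˡ j))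
  (trans (sum-cong-≗ λ r → cong f (eqʳ r)) (∑-remQuot m n λ (i , j) → f (suc i , j))))
  where
  eqˡ : ∀ j → remQuot {suc m} n (j ↑ˡ (m * n)) ≡ (zero , j)
  eqˡ j rewrite splitAt-↑ˡ n j (m * n) = refl
  eqʳ : ∀ r → remQuot {suc m} n (n ↑ʳ r) ≡ (suc (proj₁ (remQuot n r)) , proj₂ (remQuot {m} n r))
  eqʳ r rewrite splitAt-↑ʳ n (m * n) r = refl

∑-% : ∀ q m .{{_ : NonZero m}} (f : ℕ → ℕ) →
      ∑[ r < q * m ] f (toℕ r % m) ≡ q * ∑[ j < m ] f (toℕ j)
∑-% zero    m f = refl
∑-% (suc q) m f = trans (∑-++ m (λ r → f (toℕ r % m))) (cong₂ _+_
  (sum-cong-≗ λ j → cong f (trans (cong (_% m) (toℕ-↑ˡ j (q * m))) (m<n⇒m%n≡m (Fin.toℕ<n j))))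
  (trans (sum-cong-≗ λ (r : Fin (q * m)) → cong f
    (trans (cong (_% m) (trans (toℕ-↑ʳ m r) (+-comm m (toℕ r)))) ([m+n]%n≡m%n (toℕ r) m)))
    (∑-% q m f)))

module _ {U M : Set} {c : ℕ} (step : Fin c → U → M → M) where

  -- An expectation with its denominator cleared: the sum runs over all coin sequences, and by
  -- `total-const` the denominator is `c ^ length σ`.
  total : List U → (M → ℕ) → M → ℕ
  total []      G x = G x
  total (u ∷ σ) G x = ∑[ r < c ] total σ G (step r u x)

  total-cong : ∀ σ {F G} → (∀ x → F x ≡ G x) → ∀ x → total σ F x ≡ total σ G x
  total-cong []      F≡G x = F≡G x
  total-cong (u ∷ σ) F≡G x = sum-cong-≗ λ r → total-cong σ F≡G (step r u x)

  total-+ : ∀ σ F G x → total σ (λ y → F y + G y) x ≡ total σ F x + total σ G x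
  total-+ []      F G x = refl
  total-+ (u ∷ σ) F G x =
    trans (sum-cong-≗ λ r → total-+ σ F G (step r u x)) (∑-distrib-+ _ (λ r → total σ G (step r u x)))

  total-* : ∀ σ k F x → total σ (λ y → k * F y) x ≡ k * total σ F x
  total-* []      k F x = refl
  total-* (u ∷ σ) k F x =
    trans (sum-cong-≗ λ r → total-* σ k F (step r u x)) (sym (*-distribˡ-sum k (λ r → total σ F (step r u x))))

  total-const : ∀ σ k x → total σ (λ _ → k) x ≡ c ^ length σ * k
  total-const []      k x = sym (*-identityˡ k)
  total-const (u ∷ σ) k x = trans (sum-cong-≗ λ r → total-const σ k (step r u x))
    (trans (∑-const c _) (sym (*-assoc c _ k)))

  total-mono : ∀ σ {F G} → (∀ x → F x ≤ G x) → ∀ x → total σ F x ≤ total σ G x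
  total-mono []      F≤G x = F≤G x
  total-mono (u ∷ σ) F≤G x = ∑-mono λ r → total-mono σ F≤G (step r u x)

infixr 7 _⊗_

_⊗_ : {U M M′ : Set} {c c′ : ℕ} → (Fin c → U → M → M) → (Fin c′ → U → M′ → M′) →
      Fin (c * c′) → U → M × M′ → M × M′
_⊗_ {c = c} {c′} s t r u (x , y) = s (proj₁ (remQuot c′ r)) u x , t (proj₂ (remQuot {c} c′ r)) u y

∑-*-∑ : ∀ {m n} (f : Fin m → ℕ) (g : Fin n → ℕ) → ∑[ i < m ] ∑[ j < n ] (f i * g j) ≡ sum f * sum g
∑-*-∑ f g = trans (sum-cong-≗ λ i → sym (*-distribˡ-sum (f i) g)) (sym (*-distribʳ-sum (sum g) f))

-- Independence: a coin of `s ⊗ t` is a pair of coins, so the sum over coin sequences factors.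
total-⊗ : {U M M′ : Set} {c c′ : ℕ} (s : Fin c → U → M → M) (t : Fin c′ → U → M′ → M′) →
          ∀ σ F G x y → total (s ⊗ t) σ (λ (x , y) → F x * G y) (x , y) ≡ total s σ F x * total t σ G y
total-⊗ s t []      F G x y = refl
total-⊗ {c = c} {c′} s t (u ∷ σ) F G x y =
  trans (sum-cong-≗ λ r → total-⊗ s t σ F G (s (proj₁ (remQuot c′ r)) u x) (t (proj₂ (remQuot {c} c′ r)) u y))
  (trans (∑-remQuot c c′ λ (i , j) → total s σ F (s i u x) * total t σ G (t j u y))
    (∑-*-∑ (λ i → total s σ F (s i u x)) (λ j → total t σ G (t j u y))))

-- Samplers and the moments of independent copies

record Sampler (n : ℕ) : Set₁ where
  field
    Memory      : Set
    coins       : ℕ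
    {{coins≢0}} : NonZero coins
    init        : Fin coins → Memory
    step        : Fin coins → Update n → Memory → Memory
    value       : Memory → ℕ

  outcomes : List (Update n) → ℕ
  -- One coin more than updates, because `init` draws one as well.
  outcomes σ = coins ^ suc (length σ)

  runs : List (Update n) → (Memory → ℕ) → ℕ
  runs σ G = ∑[ r < coins ] total step σ G (init r)

  runs-cong : ∀ σ {F G} → (∀ x → F x ≡ G x) → runs σ F ≡ runs σ G
  runs-cong σ F≡G = sum-cong-≗ λ r → total-cong step σ F≡G (init r)

  runs-+ : ∀ σ F G → runs σ (λ x → F x + G x) ≡ runs σ F + runs σ G
  runs-+ σ F G = trans (sum-cong-≗ λ r → total-+ step σ F G (init r)) (∑-distrib-+ _ (λ r → total step σ G (init r)))

  runs-* : ∀ σ k F → runs σ (λ x → k * F x) ≡ k * runs σ F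
  runs-* σ k F = trans (sum-cong-≗ λ r → total-* step σ k F (init r)) (sym (*-distribˡ-sum k λ r → total step σ F (init r)))

  runs-const : ∀ σ k → runs σ (λ _ → k) ≡ outcomes σ * k
  runs-const σ k = trans (sum-cong-≗ λ r → total-const step σ k (init r))
    (trans (∑-const coins _) (sym (*-assoc coins _ k)))

  record Moments (σ : List (Update n)) (μ V : ℕ) : Set where
    field
      first  : runs σ value ≡ outcomes σ * μ
      second : runs σ (λ x → value x * value x) ≤ outcomes σ * V

module _ {n : ℕ} where

  open Sampler using (runs; outcomes; Moments)
  open Moments

  _⊗ˢ_ : Sampler n → Sampler n → Sampler n
  A ⊗ˢ B = record
    { Memory  = A.Memory × B.Memory
    ; coins   = A.coins * B.coins
    ; coins≢0 = m*n≢0 A.coins B.coins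
    ; init    = λ r → A.init (proj₁ (remQuot B.coins r)) , B.init (proj₂ (remQuot {A.coins} B.coins r))
    ; step    = A.step ⊗ B.step
    ; value   = λ (x , y) → A.value x + B.value y
    }
    where
    module A = Sampler A
    module B = Sampler B

  copies : ℕ → Sampler n → Sampler n
  copies zero    A = record
    { Memory = ⊤ ; coins = 1 ; init = λ _ → tt ; step = λ _ _ _ → tt ; value = λ _ → 0 }
  copies (suc k) A = A ⊗ˢ copies k A

  runs-⊗ : ∀ A B σ F G → runs (A ⊗ˢ B) σ (λ (x , y) → F x * G y) ≡ runs A σ F * runs B σ G
  runs-⊗ A B σ F G =
    trans (sum-cong-≗ λ r → total-⊗ A.step B.step σ F G
            (A.init (proj₁ (remQuot B.coins r))) (B.init (proj₂ (remQuot {A.coins} B.coins r))))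
    (trans (∑-remQuot A.coins B.coins λ (i , j) → total A.step σ F (A.init i) * total B.step σ G (B.init j))
      (∑-*-∑ (λ i → total A.step σ F (A.init i)) (λ j → total B.step σ G (B.init j))))
    where
    module A = Sampler A
    module B = Sampler B

  outcomes-⊗ : ∀ A B σ → outcomes (A ⊗ˢ B) σ ≡ outcomes A σ * outcomes B σ
  outcomes-⊗ A B σ = ^-distrib-* (Sampler.coins A) (Sampler.coins B) (suc (length σ))

  -- By independence the cross term of the square has mean exactly `2 * (μ * μ′)`; only the two pure
  -- squares are estimated.
  ⊗-moments : ∀ {A B σ μ μ′ V V′} → Moments A σ μ V → Moments B σ μ′ V′ →
              Moments (A ⊗ˢ B) σ (μ + μ′) (V + 2 * (μ * μ′) + V′)
  ⊗-moments {A} {B} {σ} {μ} {μ′} {V} {V′} a b = record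
    { first = begin-equality
        runs A⊗B σ (λ (x , y) → X x + Y y)
          ≡⟨ AB.runs-cong σ (λ (x , y) → cong₂ _+_ (sym (*-identityʳ (X x))) (sym (*-identityˡ (Y y)))) ⟩
        runs A⊗B σ (λ (x , y) → X x * 1 + 1 * Y y)
          ≡⟨ AB.runs-+ σ _ _ ⟩
        runs A⊗B σ (λ (x , y) → X x * 1) + runs A⊗B σ (λ (x , y) → 1 * Y y)
          ≡⟨ cong₂ _+_ (runs-⊗ A B σ X (λ _ → 1)) (runs-⊗ A B σ (λ _ → 1) Y) ⟩
        runs A σ X * runs B σ (λ _ → 1) + runs A σ (λ _ → 1) * runs B σ Y
          ≡⟨ cong₂ _+_ (cong₂ _*_ (first a) (B.runs-const σ 1)) (cong₂ _*_ (A.runs-const σ 1) (first b)) ⟩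
        (N * μ) * (N′ * 1) + (N * 1) * (N′ * μ′)
          ≡⟨ eq₁ N N′ μ μ′ ⟩
        (N * N′) * (μ + μ′)
          ≡⟨ cong (_* (μ + μ′)) (sym (outcomes-⊗ A B σ)) ⟩
        outcomes A⊗B σ * (μ + μ′) ∎
    ; second = begin
        runs A⊗B σ (λ (x , y) → (X x + Y y) * (X x + Y y))
          ≡⟨ AB.runs-cong σ (λ (x , y) → sq (X x) (Y y)) ⟩
        runs A⊗B σ (λ (x , y) → (X x * X x) * 1 + (2 * (X x * Y y) + 1 * (Y y * Y y)))
          ≡⟨ trans (AB.runs-+ σ _ _) (cong (runs A⊗B σ (λ (x , y) → (X x * X x) * 1) +_)
               (trans (AB.runs-+ σ _ _) (cong (_+ runs A⊗B σ (λ (x , y) → 1 * (Y y * Y y))) (AB.runs-* σ 2 _)))) ⟩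
        runs A⊗B σ (λ (x , y) → (X x * X x) * 1) +
          (2 * runs A⊗B σ (λ (x , y) → X x * Y y) + runs A⊗B σ (λ (x , y) → 1 * (Y y * Y y)))
          ≡⟨ cong₂ _+_ (runs-⊗ A B σ (λ x → X x * X x) (λ _ → 1))
               (cong₂ _+_ (cong (2 *_) (runs-⊗ A B σ X Y)) (runs-⊗ A B σ (λ _ → 1) (λ y → Y y * Y y))) ⟩
        runs A σ (λ x → X x * X x) * runs B σ (λ _ → 1) +
          (2 * (runs A σ X * runs B σ Y) + runs A σ (λ _ → 1) * runs B σ (λ y → Y y * Y y))
          ≡⟨ cong₂ _+_ (cong (runs A σ (λ x → X x * X x) *_) (B.runs-const σ 1))
               (cong₂ _+_ (cong (2 *_) (cong₂ _*_ (first a) (first b)))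
                          (cong (_* runs B σ (λ y → Y y * Y y)) (A.runs-const σ 1))) ⟩
        runs A σ (λ x → X x * X x) * (N′ * 1) +
          (2 * ((N * μ) * (N′ * μ′)) + (N * 1) * runs B σ (λ y → Y y * Y y))
          ≤⟨ +-mono-≤ (*-monoˡ-≤ (N′ * 1) (second a))
               (+-monoʳ-≤ (2 * ((N * μ) * (N′ * μ′))) (*-monoʳ-≤ (N * 1) (second b))) ⟩
        (N * V) * (N′ * 1) + (2 * ((N * μ) * (N′ * μ′)) + (N * 1) * (N′ * V′))
          ≡⟨ eq₂ N N′ μ μ′ V V′ ⟩
        (N * N′) * (V + 2 * (μ * μ′) + V′)
          ≡⟨ cong (_* (V + 2 * (μ * μ′) + V′)) (sym (outcomes-⊗ A B σ)) ⟩
        outcomes A⊗B σ * (V + 2 * (μ * μ′) + V′) ∎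
    }
    where
    open ≤-Reasoning
    A⊗B = A ⊗ˢ B
    module A = Sampler A
    module B = Sampler B
    module AB = Sampler A⊗B
    X = A.value
    Y = B.value
    N = outcomes A σ
    N′ = outcomes B σ
    sq : ∀ x y → (x + y) * (x + y) ≡ (x * x) * 1 + (2 * (x * y) + 1 * (y * y))
    sq = solve-∀
    eq₁ : ∀ N N′ μ μ′ → (N * μ) * (N′ * 1) + (N * 1) * (N′ * μ′) ≡ (N * N′) * (μ + μ′)
    eq₁ = solve-∀
    eq₂ : ∀ N N′ μ μ′ V V′ → (N * V) * (N′ * 1) + (2 * ((N * μ) * (N′ * μ′)) + (N * 1) * (N′ * V′)) ≡
          (N * N′) * (V + 2 * (μ * μ′) + V′)
    eq₂ = solve-∀

  -- The form exhibits `k * V` as a bound on the variance, as `chebyshev` expects it. It is generous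
  -- by `μ * μ` per copy, because `V` bounds the second moment and not the variance of a copy.
  copies-moments : ∀ k {A σ μ V} → Moments A σ μ V → Moments (copies k A) σ (k * μ) (k * V + k * μ * (k * μ))
  copies-moments zero {A} {σ} a = record
    { first  = trans (Sampler.runs-const (copies zero A) σ 0) refl
    ; second = ≤-reflexive (Sampler.runs-const (copies zero A) σ 0)
    }
  copies-moments (suc k) {A} {σ} {μ} {V} a = record
    { first  = first m
    ; second = ≤-trans (second m) (*-monoʳ-≤ (outcomes (copies (suc k) A) σ)
        (≤-trans (m≤m+n _ (μ * μ)) (≤-reflexive (eq μ V k))))
    }
    where
    m = ⊗-moments a (copies-moments k a)
    eq : ∀ μ V k → V + 2 * (μ * (k * μ)) + (k * V + k * μ * (k * μ)) + μ * μ ≡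
         (V + k * V) + (μ + k * μ) * (μ + k * μ)
    eq = solve-∀

-- Births of edges

isOne : ℕ → ℕ
isOne 1 = 1
isOne _ = 0

isOne≤1 : ∀ x → isOne x ≤ 1
isOne≤1 0             = z≤n
isOne≤1 1             = ≤-refl
isOne≤1 (suc (suc _)) = z≤n

module Tracker (B : ℕ) where

  -- Truncated subtraction is the reflection at 0. The cap `B` bounds the memory on arbitrary
  -- streams and does not act on valid ones.
  shift : ℕ → ℤ → ℕ
  shift s (ℤ.+ a)    = (s + a) ⊓ B
  shift s -[1+ a ] = (s ∸ suc a) ⊓ B

  absorb : ℕ → ℤ → ℕ
  absorb zero      z = 0
  absorb s@(suc _) z = shift s z

  reflected absorbed : ℕ → List ℤ → ℕ
  reflected s []       = isOne s
  reflected s (z ∷ zs) = reflected (shift s z) zs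
  absorbed s []       = isOne s
  absorbed s (z ∷ zs) = absorbed (absorb s z) zs

  -- As shift truncates to [0 , B], exactness says that the walk stays there.
  Walk : ℕ → List ℤ → Set
  Walk x []       = x ≤ 1
  Walk x (z ∷ zs) = ℤ.+ shift x z ≡ ℤ.+ x ℤ.+ z × Walk (shift x z) zs

  shift≤B : ∀ s z → shift s z ≤ B
  shift≤B s (ℤ.+ a)    = m⊓n≤n (s + a) B
  shift≤B s -[1+ a ] = m⊓n≤n (s ∸ suc a) B

  absorb≤B : ∀ s z → absorb s z ≤ B
  absorb≤B zero    z = z≤n
  absorb≤B (suc s) z = shift≤B (suc s) z

  shift-mono : ∀ {s x} z → s ≤ x → shift s z ≤ shift x z
  shift-mono (ℤ.+ a)    s≤x = ⊓-monoˡ-≤ B (+-monoˡ-≤ a s≤x)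
  shift-mono -[1+ a ] s≤x = ⊓-monoˡ-≤ B (∸-monoˡ-≤ (suc a) s≤x)

  -- A move that is exact for `x` moves `s` by the same amount unless `s` is truncated at 0; the cap
  -- can only lower the smaller value further.
  shift-< : ∀ {s x} z → s < x → ℤ.+ shift x z ≡ ℤ.+ x ℤ.+ z → shift s z ≡ 0 ⊎ shift s z < shift x z
  shift-< {s} {x} (ℤ.+ a) s<x exact = inj₂ (<-≤-trans
    (≤-<-trans (m⊓n≤m (s + a) B) (+-monoˡ-< a s<x))
    (≤-reflexive (sym (ℤ.+-injective exact))))
  shift-< {s} {x} -[1+ a ] s<x exact with suc a <? s
  ... | no  a≮s = inj₁ (cong (_⊓ B) (m≤n⇒m∸n≡0 (≮⇒≥ a≮s)))
  ... | yes a<s = inj₂ (<-≤-trans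
    (≤-<-trans (m⊓n≤m (s ∸ suc a) B) (∸-monoˡ-< s<x (<⇒≤ a<s)))
    (≤-reflexive (sym (ℤ.+-injective (trans exact (ℤ.⊖-≥ (<⇒≤ (<-trans a<s s<x))))))))

  reflected≤1 : ∀ s zs → reflected s zs ≤ 1
  reflected≤1 s []       = isOne≤1 s
  reflected≤1 s (z ∷ zs) = reflected≤1 (shift s z) zs

  absorbed-zero : ∀ zs → absorbed 0 zs ≡ 0
  absorbed-zero []       = refl
  absorbed-zero (z ∷ zs) = absorbed-zero zs

  -- A deficit against the true multiplicity is permanent until absorption. As the walk ends in at
  -- most 1, a tracker strictly below it ends in 0. So a tracker started at 0 while the multiplicity
  -- is positive never reports a birth.
  absorbed-< : ∀ {s x} zs → Walk x zs → s < x → absorbed s zs ≡ 0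
  absorbed-< {s = zero}  zs       w           s<x       = absorbed-zero zs
  absorbed-< {s = suc s} []       (s≤s z≤n)   (s≤s ())
  absorbed-< {s = suc s} (z ∷ zs) (exact , w) s<x with shift-< z s<x exact
  ... | inj₁ s′≡0  = trans (cong (λ t → absorbed t zs) s′≡0) (absorbed-zero zs)
  ... | inj₂ s′<x′ = absorbed-< zs w s′<x′

  -- There are two ways for the reflected tracker to end in 1: to stay positive
  -- from here on, or to return to 0, where it meets the tracker started at 0.
  reflected-split : ∀ {s x} zs → Walk x zs → s ≤ x →
                    reflected s zs ≡ absorbed s zs + reflected 0 zs
  reflected-split {s}         []       w           s≤x = sym (+-identityʳ (isOne s))
  reflected-split {s = zero}  (z ∷ zs) w           s≤x = cong (_+ reflected 0 (z ∷ zs)) (sym (absorbed-zero zs))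
  reflected-split {s = suc s} (z ∷ zs) (exact , w) s≤x =
    trans (reflected-split zs w (shift-mono z s≤x)) (cong (absorbed (shift (suc s) z) zs +_) (sym restart))
    where
    -- The multiplicity is positive before `z`, so `z` is no birth: a tracker started at 0 just
    -- before `z` has a deficit, and starting after `z` gives the same result.
    restart : reflected (shift 0 z) zs ≡ reflected 0 zs
    restart with shift-< z (≤-trans (s≤s z≤n) s≤x) exact
    ... | inj₁ s′≡0  = cong (λ t → reflected t zs) s′≡0
    ... | inj₂ s′<x′ = trans (reflected-split zs w (<⇒≤ s′<x′))
                             (cong (_+ reflected 0 zs) (absorbed-< zs w s′<x′))

  -- Started at the true multiplicity, the tracker is never reflected or capped, so it ends at the
  -- true final multiplicity.
  reflected-Walk : ∀ x zs → Walk x zs →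
                   ∃[ y ] ℤ.+ y ≡ ℤ.+ x ℤ.+ List.foldr ℤ._+_ 0ℤ zs × reflected x zs ≡ isOne y
  reflected-Walk x []       w = x , sym (ℤ.+-identityʳ (ℤ.+ x)) , refl
  reflected-Walk x (z ∷ zs) (exact , w) with y , eq , r ← reflected-Walk (shift x z) zs w =
    y , trans eq (trans (cong (ℤ._+ List.foldr ℤ._+_ 0ℤ zs) exact) (ℤ.+-assoc (ℤ.+ x) z _)) , r

module _ {n : ℕ} where

  Joins : Fin n → Fin n → Edge n → Set
  Joins u v e = (Edge.lo e ≡ u × Edge.hi e ≡ v) ⊎ (Edge.lo e ≡ v × Edge.hi e ≡ u)

  joins? : ∀ u v e → Dec (Joins u v e)
  joins? u v e = ((Edge.lo e Fin.≟ u) ×-dec (Edge.hi e Fin.≟ v)) ⊎-dec ((Edge.lo e Fin.≟ v) ×-dec (Edge.hi e Fin.≟ u))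

  lo≢hi : (e : Edge n) → Edge.lo e ≢ Edge.hi e
  lo≢hi (edge a b a<b) a≡b = ⊥-elim-irr (<⇒≢ a<b (cong toℕ a≡b))

  joins-other : ∀ {u v w e} → Joins u v e → Joins v w e → u ≡ w
  joins-other {e = e} (inj₁ (a , b)) (inj₁ (c , d)) = contradiction (trans c (sym b)) (lo≢hi e)
  joins-other         (inj₁ (a , b)) (inj₂ (c , d)) = trans (sym a) c
  joins-other         (inj₂ (a , b)) (inj₁ (c , d)) = trans (sym b) d
  joins-other {e = e} (inj₂ (a , b)) (inj₂ (c , d)) = contradiction (trans a (sym d)) (lo≢hi e)

  joins-irrefl : ∀ {u e} → ¬ Joins u u e
  joins-irrefl {e = e} (inj₁ (a , b)) = lo≢hi e (trans a (sym b))
  joins-irrefl {e = e} (inj₂ (a , b)) = lo≢hi e (trans a (sym b))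

  joins-sym : ∀ {u v e} → Joins u v e → Joins v u e
  joins-sym (inj₁ p) = inj₂ p
  joins-sym (inj₂ p) = inj₁ p

  increment : Fin n → Fin n → Update n → ℤ
  increment u v (e , Δ) = if does (joins? u v e) then Δ else 0ℤ

  -- One entry per update, with 0 for updates of other edges, so that the walks of all pairs run in
  -- step with the stream.
  increments : Fin n → Fin n → List (Update n) → List ℤ
  increments u v = List.map (increment u v)

  increment-sym : ∀ u v p → increment u v p ≡ increment v u p
  increment-sym u v (e , Δ) = cong (if_then Δ else 0ℤ)
    (∨-comm (does ((Edge.lo e Fin.≟ u) ×-dec (Edge.hi e Fin.≟ v))) _)

  increments-sym : ∀ u v τ → increments u v τ ≡ increments v u τ
  increments-sym u v = map-cong (increment-sym u v)

  increment-∦ : ∀ {u v} p → ¬ Joins u v (proj₁ p) → increment u v p ≡ 0ℤ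
  increment-∦ {u} {v} (e , Δ) ¬j = cong (if_then Δ else 0ℤ) (dec-false (joins? u v e) ¬j)

  increment-∥ : ∀ {u v} p → Joins u v (proj₁ p) → increment u v p ≡ proj₂ p
  increment-∥ {u} {v} (e , Δ) j = cong (if_then Δ else 0ℤ) (dec-true (joins? u v e) j)

-- Triangles counted by the births of their edges

module Triangles (B n : ℕ) where

  open Tracker B public

  -- The multiplicities before `τ` are left open, so that every suffix of an admissible list is
  -- admissible.
  Admissible : List (Update n) → Set
  Admissible τ = ∀ u v → ∃[ x ] Walk x (increments u v τ)

  -- Whether the birth of uv is an update of τ, and whether it is the update p
  -- that precedes τ.
  born : Fin n → Fin n → List (Update n) → ℕ
  born u v τ = reflected 0 (increments u v τ)

  birth : Fin n → Fin n → Update n → List (Update n) → ℕ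
  birth u v p τ = absorbed (shift 0 (increment u v p)) (increments u v τ)

  admissible-tail : ∀ p τ → Admissible (p ∷ τ) → Admissible τ
  admissible-tail p τ ok u v with x , (_ , w) ← ok u v = _ , w

  -- This is `reflected-split` just after `p`: a tracker that is at 0 before `p` lies below the true
  -- multiplicity, whatever that is.
  born-∷ : ∀ p τ → Admissible (p ∷ τ) → ∀ u v → born u v (p ∷ τ) ≡ birth u v p τ + born u v τ
  born-∷ p τ ok u v with x , (_ , w) ← ok u v =
    reflected-split (increments u v τ) w (shift-mono (increment u v p) z≤n)

  born-sym : ∀ u v τ → born u v τ ≡ born v u τ
  born-sym u v τ = cong (reflected 0) (increments-sym u v τ)

  birth-sym : ∀ u v p τ → birth u v p τ ≡ birth v u p τ
  birth-sym u v p τ = cong₂ (λ z → absorbed (shift 0 z)) (increment-sym u v p) (increments-sym u v τ)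

  born≤1 : ∀ u v τ → born u v τ ≤ 1
  born≤1 u v τ = reflected≤1 0 (increments u v τ)

  birth-∦ : ∀ {u v} p τ → ¬ Joins u v (proj₁ p) → birth u v p τ ≡ 0
  birth-∦ {u} {v} p τ ¬j = trans (cong (λ z → absorbed (shift 0 z) (increments u v τ)) (increment-∦ p ¬j))
    (absorbed-zero (increments u v τ))

  birth-irrefl : ∀ u p τ → birth u u p τ ≡ 0
  birth-irrefl u p τ = birth-∦ {u} {u} p τ (joins-irrefl {e = proj₁ p})

  born-irrefl : ∀ u τ → born u u τ ≡ 0
  born-irrefl u []      = refl
  born-irrefl u (p ∷ τ) rewrite increment-∦ {u = u} {v = u} p (joins-irrefl {e = proj₁ p}) = born-irrefl u τ

  -- An update belongs to a single edge, so two different edges cannot both be born at it.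
  birth-clash : ∀ {u v w} p τ → u ≢ w → birth u v p τ * birth v w p τ ≡ 0
  birth-clash {u} {v} {w} p τ u≢w with joins? u v (proj₁ p)
  ... | no ¬j = cong (_* birth v w p τ) (birth-∦ p τ ¬j)
  ... | yes j = trans (cong (birth u v p τ *_) (birth-∦ p τ λ j′ → u≢w (joins-other {e = proj₁ p} j j′))) (*-zeroʳ (birth u v p τ))

  -- `pending u v` counts the common neighbours w for which vw is born before uw. These are the
  -- triangles that a sampler with first edge uv, oriented towards v, can still find.
  codegree pending : Fin n → Fin n → List (Update n) → ℕ
  codegree u v τ = ∑[ w < n ] (born v w τ * born u w τ)

  pending u v []      = 0
  pending u v (p ∷ τ) = ∑[ w < n ] (birth v w p τ * born u w τ) + pending u v τ

  -- A common neighbour w is counted on the right once, according to which of vw and uw is born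
  -- first; by `birth-clash` there are no ties.
  codegree-pending : ∀ {u v} τ → Admissible τ → u ≢ v → codegree u v τ ≡ pending u v τ + pending v u τ
  codegree-pending []              ok u≢v = ∑-zero {n} λ w → refl
  codegree-pending {u} {v} (p ∷ τ) ok u≢v = begin-equality
    ∑[ w < n ] (born v w (p ∷ τ) * born u w (p ∷ τ))
      ≡⟨ sum-cong-≗ step ⟩
    ∑[ w < n ] (β v w * b u w + (β u w * b v w + b v w * b u w))
      ≡⟨ trans (∑-distrib-+ (λ w → β v w * b u w) _) (cong (∑[ w < n ] (β v w * b u w) +_) (∑-distrib-+ (λ w → β u w * b v w) _)) ⟩
    ∑[ w < n ] (β v w * b u w) + (∑[ w < n ] (β u w * b v w) + codegree u v τ)
      ≡⟨ cong (λ c → ∑[ w < n ] (β v w * b u w) + (∑[ w < n ] (β u w * b v w) + c)) (codegree-pending τ (admissible-tail p τ ok) u≢v) ⟩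
    ∑[ w < n ] (β v w * b u w) + (∑[ w < n ] (β u w * b v w) + (pending u v τ + pending v u τ))
      ≡⟨ shuffle (∑[ w < n ] (β v w * b u w)) (∑[ w < n ] (β u w * b v w)) (pending u v τ) (pending v u τ) ⟩
    ∑[ w < n ] (β v w * b u w) + pending u v τ + (∑[ w < n ] (β u w * b v w) + pending v u τ) ∎
    where
    open ≤-Reasoning
    β b : Fin n → Fin n → ℕ
    β u v = birth u v p τ
    b u v = born u v τ
    shuffle : ∀ a b c d → a + (b + (c + d)) ≡ a + c + (b + d)
    shuffle = solve-∀
    expand : ∀ x y z w → (x + y) * (z + w) ≡ x * w + (z * y + y * w) + z * x
    expand = solve-∀
    step : ∀ w → born v w (p ∷ τ) * born u w (p ∷ τ) ≡ β v w * b u w + (β u w * b v w + b v w * b u w)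
    step w = trans (cong₂ _*_ (born-∷ p τ ok v w) (born-∷ p τ ok u w))
      (trans (expand (β v w) (b v w) (β u w) (b u w))
      (trans (cong (β v w * b u w + (β u w * b v w + b v w * b u w) +_)
               (trans (cong (β u w *_) (birth-sym v w p τ)) (birth-clash p τ u≢v)))
             (+-identityʳ _)))

  ordered : List (Update n) → ℕ
  ordered τ = ∑[ u < n ] ∑[ v < n ] ∑[ w < n ] (born u v τ * born v w τ * born u w τ)

  ∑-rotate : (f : Fin n → Fin n → Fin n → ℕ) →
             ∑[ u < n ] ∑[ v < n ] ∑[ w < n ] f v w u ≡ ∑[ u < n ] ∑[ v < n ] ∑[ w < n ] f u v w
  ∑-rotate f = trans (∑-comm λ u v → ∑[ w < n ] f v w u) (sum-cong-≗ λ v → ∑-comm λ u w → f v w u)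

  ∑-swap : (f : Fin n → Fin n → Fin n → ℕ) →
           ∑[ u < n ] ∑[ v < n ] ∑[ w < n ] f u w v ≡ ∑[ u < n ] ∑[ v < n ] ∑[ w < n ] f u v w
  ∑-swap f = sum-cong-≗ λ u → ∑-comm λ v w → f u w v

  ∑³-distrib-+ : (f g : Fin n → Fin n → Fin n → ℕ) →
    ∑[ u < n ] ∑[ v < n ] ∑[ w < n ] (f u v w + g u v w) ≡
    ∑[ u < n ] ∑[ v < n ] ∑[ w < n ] f u v w + ∑[ u < n ] ∑[ v < n ] ∑[ w < n ] g u v w
  ∑³-distrib-+ f g = trans
    (sum-cong-≗ λ u → trans (sum-cong-≗ λ v → ∑-distrib-+ (f u v) (g u v))
      (∑-distrib-+ (λ v → ∑[ w < n ] f u v w) (λ v → ∑[ w < n ] g u v w)))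
    (∑-distrib-+ (λ u → ∑[ v < n ] ∑[ w < n ] f u v w) (λ u → ∑[ v < n ] ∑[ w < n ] g u v w))

  -- At most one edge of a triple can be born at `p`. The three places where this edge can stand
  -- give equal sums after renaming the vertices, hence the 3.
  ordered-∷ : ∀ p τ → Admissible (p ∷ τ) →
    ordered (p ∷ τ) ≡ 3 * ∑[ u < n ] ∑[ v < n ] (birth u v p τ * codegree u v τ) + ordered τ
  ordered-∷ p τ ok = begin-equality
    ∑[ u < n ] ∑[ v < n ] ∑[ w < n ] (born u v (p ∷ τ) * born v w (p ∷ τ) * born u w (p ∷ τ))
      ≡⟨ sum-cong-≗ (λ u → sum-cong-≗ λ v → sum-cong-≗ λ w → step u v w) ⟩
    ∑[ u < n ] ∑[ v < n ] ∑[ w < n ] (f u v w + (f v w u + (f u w v + g u v w)))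
      ≡⟨ trans (∑³-distrib-+ f _) (cong (F +_) (trans (∑³-distrib-+ (λ u v w → f v w u) _)
           (cong₂ _+_ (∑-rotate f) (trans (∑³-distrib-+ (λ u v w → f u w v) g) (cong (_+ ordered τ) (∑-swap f)))))) ⟩
    F + (F + (F + ordered τ))
      ≡⟨ triple F (ordered τ) ⟩
    3 * F + ordered τ
      ≡⟨ cong (λ x → 3 * x + ordered τ) (sum-cong-≗ λ u → sum-cong-≗ λ v → sym (*-distribˡ-sum (β u v) (λ w → b v w * b u w))) ⟩
    3 * ∑[ u < n ] ∑[ v < n ] (β u v * codegree u v τ) + ordered τ ∎
    where
    open ≤-Reasoning
    β b : Fin n → Fin n → ℕ
    β u v = birth u v p τ
    b u v = born u v τ
    f g : Fin n → Fin n → Fin n → ℕ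
    f u v w = β u v * (b v w * b u w)
    g u v w = b u v * b v w * b u w
    F = ∑[ u < n ] ∑[ v < n ] ∑[ w < n ] f u v w
    triple : ∀ x y → x + (x + (x + y)) ≡ 3 * x + y
    triple = solve-∀
    expand : ∀ x x′ y y′ z z′ → (x + x′) * (y + y′) * (z + z′) ≡
      x * (y′ * z′) + (y * (z′ * x′) + (z * (y′ * x′) + x′ * y′ * z′)) + (x * y * (z + z′) + (x * z * y′ + y * z * x′))
    expand = solve-∀
    -- Two births at `p` with common end v force `u ≡ w`. The remaining factor then belongs to the
    -- degenerate edge uu and vanishes.
    clash : ∀ u v w x → (u ≡ w → x ≡ 0) → β u v * β v w * x ≡ 0
    clash u v w x x≡0 with u Fin.≟ w
    ... | yes u≡w = trans (cong (β u v * β v w *_) (x≡0 u≡w)) (*-zeroʳ (β u v * β v w))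
    ... | no  u≢w = cong (_* x) (birth-clash p τ u≢w)
    step : ∀ u v w → born u v (p ∷ τ) * born v w (p ∷ τ) * born u w (p ∷ τ) ≡ f u v w + (f v w u + (f u w v + g u v w))
    step u v w = trans (cong₂ _*_ (cong₂ _*_ (born-∷ p τ ok u v) (born-∷ p τ ok v w)) (born-∷ p τ ok u w))
      (trans (expand (β u v) (b u v) (β v w) (b v w) (β u w) (b u w))
      (trans (cong₂ _+_
        (cong (f u v w +_) (cong₂ _+_
          (cong (β v w *_) (cong₂ _*_ (born-sym u w τ) (born-sym u v τ)))
          (cong (_+ g u v w) (cong (λ x → β u w * (x * b u v)) (born-sym v w τ)))))
        (cong₂ _+_ (clash u v w (β u w + b u w) λ { refl → cong₂ _+_ (birth-irrefl u p τ) (born-irrefl u τ) })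
          (cong₂ _+_
            (trans (cong (λ x → x * β u w * b v w) (birth-sym u v p τ)) (clash v u w (b v w) λ { refl → born-irrefl v τ }))
            (trans (cong (λ x → β v w * x * b u v) (birth-sym u w p τ)) (clash v w u (b u v) λ { refl → born-irrefl u τ })))))
      (+-identityʳ _)))

  ordered-[] : ordered [] ≡ 0
  ordered-[] = ∑-zero {n} λ u → ∑-zero {n} λ v → ∑-zero {n} λ w → refl

  birth-codegree : ∀ p τ → Admissible (p ∷ τ) → ∀ u v →
    birth u v p τ * codegree u v τ ≡ birth u v p τ * pending u v τ + birth u v p τ * pending v u τ
  birth-codegree p τ ok u v with u Fin.≟ v
  ... | yes refl rewrite birth-irrefl u p τ = refl
  ... | no  u≢v = trans (cong (birth u v p τ *_) (codegree-pending τ (admissible-tail p τ ok) u≢v))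
                        (*-distribˡ-+ (birth u v p τ) _ _)

  -- The two summands of `codegree-pending` are exchanged by reversing the orientation of uv, hence
  -- the 2.
  ∑-birth-codegree : ∀ p τ → Admissible (p ∷ τ) →
    ∑[ u < n ] ∑[ v < n ] (birth u v p τ * codegree u v τ) ≡ 2 * ∑[ u < n ] ∑[ v < n ] (birth u v p τ * pending u v τ)
  ∑-birth-codegree p τ ok = begin-equality
    ∑[ u < n ] ∑[ v < n ] (birth u v p τ * codegree u v τ)
      ≡⟨ sum-cong-≗ (λ u → trans (sum-cong-≗ (birth-codegree p τ ok u)) (∑-distrib-+ (f u) (g u))) ⟩
    ∑[ u < n ] (∑[ v < n ] f u v + ∑[ v < n ] g u v)
      ≡⟨ ∑-distrib-+ (λ u → ∑[ v < n ] f u v) (λ u → ∑[ v < n ] g u v) ⟩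
    S + ∑[ u < n ] ∑[ v < n ] g u v
      ≡⟨ cong (S +_) (trans (∑-comm g) (sum-cong-≗ λ v → sum-cong-≗ λ u → cong (_* pending v u τ) (birth-sym u v p τ))) ⟩
    S + S
      ≡⟨ cong (S +_) (sym (+-identityʳ S)) ⟩
    2 * S ∎
    where
    open ≤-Reasoning
    f g : Fin n → Fin n → ℕ
    f u v = birth u v p τ * pending u v τ
    g u v = birth u v p τ * pending v u τ
    S = ∑[ u < n ] ∑[ v < n ] f u v

  module _ (weight : Fin n → Fin n → List (Update n) → ℕ) where

    -- With weight 1 this is the number of triangles, each found from the births of its first two
    -- edges; with weight `meetings` it governs the second moment.
    weighted : List (Update n) → ℕ
    weighted []      = 0
    weighted (p ∷ τ) = ∑[ u < n ] ∑[ v < n ] (birth u v p τ * (weight u v τ * pending u v τ)) + weighted τ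

  -- The 6 is 3 · 2: which edge of the ordered triple is born first, and which of its ends lies on
  -- the second edge.
  ordered-weighted : ∀ τ → Admissible τ → ordered τ ≡ 6 * weighted (λ _ _ _ → 1) τ
  ordered-weighted []      ok = ordered-[]
  ordered-weighted (p ∷ τ) ok = begin-equality
    ordered (p ∷ τ)
      ≡⟨ ordered-∷ p τ ok ⟩
    3 * ∑[ u < n ] ∑[ v < n ] (birth u v p τ * codegree u v τ) + ordered τ
      ≡⟨ cong₂ (λ x y → 3 * x + y) (∑-birth-codegree p τ ok) (ordered-weighted τ (admissible-tail p τ ok)) ⟩
    3 * (2 * S) + 6 * weighted (λ _ _ _ → 1) τ
      ≡⟨ collect S _ ⟩
    6 * (S + weighted (λ _ _ _ → 1) τ)
      ≡⟨ cong (λ x → 6 * (x + weighted (λ _ _ _ → 1) τ)) (sum-cong-≗ λ u → sum-cong-≗ λ v →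
           cong (birth u v p τ *_) (sym (*-identityˡ (pending u v τ)))) ⟩
    6 * weighted (λ _ _ _ → 1) (p ∷ τ) ∎
    where
    open ≤-Reasoning
    S = ∑[ u < n ] ∑[ v < n ] (birth u v p τ * pending u v τ)
    collect : ∀ x y → 3 * (2 * x) + 6 * y ≡ 6 * (x + y)
    collect = solve-∀

-- Incidences and the second moment

indicator : ∀ {P : Set} → Dec P → ℕ
indicator P? = if does P? then 1 else 0

indicator-yes : ∀ {P : Set} (P? : Dec P) → P → indicator P? ≡ 1
indicator-yes P? p = cong (if_then 1 else 0) (dec-true P? p)

indicator-no : ∀ {P : Set} (P? : Dec P) → ¬ P → indicator P? ≡ 0
indicator-no P? ¬p = cong (if_then 1 else 0) (dec-false P? ¬p)

∑-indicator : ∀ {n} (j : Fin n) (f : Fin n → ℕ) → ∑[ i < n ] (indicator (j Fin.≟ i) * f i) ≡ f j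
∑-indicator j f = trans
  (∑-single _ j λ i i≢j → cong (_* f i) (indicator-no (j Fin.≟ i) (i≢j ∘ sym)))
  (trans (cong (_* f j) (indicator-yes (j Fin.≟ j) refl)) (*-identityˡ (f j)))

module _ {n : ℕ} where

  ∑-joins : (e : Edge n) (f : Fin n → Fin n → ℕ) → (∀ u v → ¬ Joins u v e → f u v ≡ 0) →
            ∑[ u < n ] ∑[ v < n ] f u v ≡ f (Edge.lo e) (Edge.hi e) + f (Edge.hi e) (Edge.lo e)
  ∑-joins e f f≡0 = trans (sum-cong-≗ λ u → sum-cong-≗ λ v → split u v)
    (trans (sum-cong-≗ λ u → trans (∑-distrib-+ (λ v → at a b u v) (λ v → at b a u v)) (cong₂ _+_ (row a b u) (row b a u)))
    (trans (∑-distrib-+ (λ u → indicator (a Fin.≟ u) * f u b) (λ u → indicator (b Fin.≟ u) * f u a))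
      (cong₂ _+_ (∑-indicator a λ u → f u b) (∑-indicator b λ u → f u a))))
    where
    a = Edge.lo e
    b = Edge.hi e
    at : Fin n → Fin n → Fin n → Fin n → ℕ
    at x y u v = indicator (y Fin.≟ v) * (indicator (x Fin.≟ u) * f u v)
    row : ∀ x y u → ∑[ v < n ] at x y u v ≡ indicator (x Fin.≟ u) * f u y
    row x y u = ∑-indicator y λ v → indicator (x Fin.≟ u) * f u v
    hit : ∀ {x y u v} → x ≡ u → y ≡ v → at x y u v ≡ f u v
    hit {x} {y} {u} {v} x≡u y≡v =
      trans (cong₂ _*_ (indicator-yes (y Fin.≟ v) y≡v) (cong (_* f u v) (indicator-yes (x Fin.≟ u) x≡u)))
        (trans (*-identityˡ (1 * f u v)) (*-identityˡ (f u v)))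
    miss : ∀ x y {u v} → y ≢ v → at x y u v ≡ 0
    miss x y {u} {v} y≢v = cong (_* (indicator (x Fin.≟ u) * f u v)) (indicator-no (y Fin.≟ v) y≢v)
    split : ∀ u v → f u v ≡ at a b u v + at b a u v
    split u v with joins? u v e
    ... | no ¬j = trans (f≡0 u v ¬j) (sym (cong₂ _+_ (vanish a b) (vanish b a)))
      where
      vanish : ∀ x y → at x y u v ≡ 0
      vanish x y = trans (cong (λ z → indicator (y Fin.≟ v) * (indicator (x Fin.≟ u) * z)) (f≡0 u v ¬j))
        (trans (cong (indicator (y Fin.≟ v) *_) (*-zeroʳ (indicator (x Fin.≟ u)))) (*-zeroʳ (indicator (y Fin.≟ v))))
    ... | yes (inj₁ (a≡u , b≡v)) = sym (trans (cong₂ _+_ (hit a≡u b≡v)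
            (miss b a λ a≡v → lo≢hi e (trans a≡v (sym b≡v)))) (+-identityʳ (f u v)))
    ... | yes (inj₂ (a≡v , b≡u)) = sym (cong₂ _+_
            (miss a b λ b≡v → lo≢hi e (trans a≡v (sym b≡v))) (hit b≡u a≡v))

  far : Fin n → Fin n → Edge n → Maybe (Fin n)
  far u v (edge a b _) with a Fin.≟ v | b Fin.≟ v
  ... | no  _ | no  _ = nothing
  ... | yes _ | _     = if does (b Fin.≟ u) then nothing else just b
  ... | no  _ | yes _ = if does (a Fin.≟ u) then nothing else just a

  data Far (u v : Fin n) (e : Edge n) : Maybe (Fin n) → Set where
    meets  : ∀ {w} → Joins v w e → w ≢ u → Far u v e (just w)
    misses : (∀ {w} → Joins v w e → w ≡ u) → Far u v e nothing

  far-view : ∀ u v e → Far u v e (far u v e)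
  far-view u v e@(edge a b _) with a Fin.≟ v | b Fin.≟ v
  ... | no a≢v | no b≢v = misses λ { (inj₁ (a≡v , _)) → contradiction a≡v a≢v ; (inj₂ (_ , b≡v)) → contradiction b≡v b≢v }
  far-view u v e@(edge a b _) | yes a≡v | _ with b Fin.≟ u
  ... | yes b≡u = misses λ { (inj₁ (_ , b≡w)) → trans (sym b≡w) b≡u ; (inj₂ (_ , b≡v)) → contradiction (trans a≡v (sym b≡v)) (lo≢hi e) }
  ... | no  b≢u = meets (inj₁ (a≡v , refl)) b≢u
  far-view u v e@(edge a b _) | no a≢v | yes b≡v with a Fin.≟ u
  ... | yes a≡u = misses λ { (inj₁ (a≡v , _)) → contradiction a≡v a≢v ; (inj₂ (a≡w , _)) → trans (sym a≡w) a≡u }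
  ... | no  a≢u = meets (inj₂ (refl , b≡v)) a≢u

  meeting : Maybe (Fin n) → ℕ
  meeting nothing  = 0
  meeting (just _) = 1

  meetings : Fin n → Fin n → List (Update n) → ℕ
  meetings u v []      = 0
  meetings u v (p ∷ τ) = meeting (far u v (proj₁ p)) + meetings u v τ

  meeting≤1 : ∀ x → meeting x ≤ 1
  meeting≤1 nothing  = z≤n
  meeting≤1 (just _) = ≤-refl

  meetings≤length : ∀ u v τ → meetings u v τ ≤ length τ
  meetings≤length u v []      = z≤n
  meetings≤length u v (p ∷ τ) = +-mono-≤ (meeting≤1 (far u v (proj₁ p))) (meetings≤length u v τ)

  -- A bound for `meetings u v` that is independent of u, so that the sum over u can be replaced by
  -- a degree.
  incidences : Fin n → List (Update n) → ℕ
  incidences v []            = 0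
  incidences v ((e , _) ∷ τ) = indicator (Edge.lo e Fin.≟ v) + indicator (Edge.hi e Fin.≟ v) + incidences v τ

  meeting≤incidence : ∀ u v e → meeting (far u v e) ≤ indicator (Edge.lo e Fin.≟ v) + indicator (Edge.hi e Fin.≟ v)
  meeting≤incidence u v e with far u v e | far-view u v e
  ... | nothing | _ = z≤n
  ... | just _  | meets (inj₁ (a≡v , _)) _ =
    ≤-trans (≤-reflexive (sym (indicator-yes (Edge.lo e Fin.≟ v) a≡v))) (m≤m+n _ _)
  ... | just _  | meets (inj₂ (_ , b≡v)) _ =
    ≤-trans (≤-reflexive (sym (indicator-yes (Edge.hi e Fin.≟ v) b≡v))) (m≤n+m _ _)

  meetings≤incidences : ∀ u v τ → meetings u v τ ≤ incidences v τ
  meetings≤incidences u v []      = z≤n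
  meetings≤incidences u v (p ∷ τ) = +-mono-≤ (meeting≤incidence u v (proj₁ p)) (meetings≤incidences u v τ)

  ∑-incidences : ∀ τ → ∑[ v < n ] incidences v τ ≡ 2 * length τ
  ∑-incidences []            = ∑-zero {n} λ v → refl
  ∑-incidences ((e , Δ) ∷ τ) = begin-equality
    ∑[ v < n ] (ind a v + ind b v + incidences v τ)
      ≡⟨ trans (∑-distrib-+ (λ v → ind a v + ind b v) _) (cong (_+ ∑[ v < n ] incidences v τ) (∑-distrib-+ (ind a) (ind b))) ⟩
    sum (ind a) + sum (ind b) + ∑[ v < n ] incidences v τ
      ≡⟨ cong₂ _+_ (cong₂ _+_ (one a) (one b)) (∑-incidences τ) ⟩
    2 + 2 * length τ
      ≡⟨ sym (*-distribˡ-+ 2 1 (length τ)) ⟩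
    2 * suc (length τ) ∎
    where
    open ≤-Reasoning
    a = Edge.lo e
    b = Edge.hi e
    ind : Fin n → Fin n → ℕ
    ind x v = indicator (x Fin.≟ v)
    one : ∀ x → sum (ind x) ≡ 1
    one x = trans (sum-cong-≗ λ v → sym (*-identityʳ (ind x v))) (∑-indicator x λ _ → 1)

module SecondMoment (B n : ℕ) where

  open Triangles B n

  pending≤codegree : ∀ {u v} τ → Admissible τ → u ≢ v → pending u v τ ≤ codegree u v τ
  pending≤codegree {u} {v} τ ok u≢v = ≤-trans (m≤m+n _ (pending v u τ)) (≤-reflexive (sym (codegree-pending τ ok u≢v)))

  codegree≤degree : ∀ u v τ → codegree u v τ ≤ ∑[ w < n ] born v w τ
  codegree≤degree u v τ = ∑-mono λ w →
    ≤-trans (*-monoʳ-≤ (born v w τ) (born≤1 u w τ)) (≤-reflexive (*-identityʳ (born v w τ)))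

  born-mono : ∀ p τ → Admissible (p ∷ τ) → ∀ u v → born u v τ ≤ born u v (p ∷ τ)
  born-mono p τ ok u v = ≤-trans (m≤n+m _ (birth u v p τ)) (≤-reflexive (sym (born-∷ p τ ok u v)))

  -- Every birth of uv is charged `a v * d`, and the births add up to `born` by `born-∷`. The bounds
  -- `a` and `d` stay fixed in the induction, since incidences and degrees only shrink when passing
  -- to a suffix.
  weighted≤∑-born : ∀ (a : Fin n → ℕ) d τ → Admissible τ → (∀ v → ∑[ w < n ] born v w τ ≤ d) →
    (∀ v → incidences v τ ≤ a v) → weighted meetings τ ≤ ∑[ u < n ] ∑[ v < n ] (born u v τ * (a v * d))
  weighted≤∑-born a d []      ok deg inc = z≤n
  weighted≤∑-born a d (p ∷ τ) ok deg inc = begin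
    ∑[ u < n ] ∑[ v < n ] (birth u v p τ * (meetings u v τ * pending u v τ)) + weighted meetings τ
      ≤⟨ +-mono-≤ (∑-mono λ u → ∑-mono λ v → head u v)
           (weighted≤∑-born a d τ ok′ deg′ (λ v → ≤-trans (m≤n+m _ _) (inc v))) ⟩
    ∑[ u < n ] ∑[ v < n ] (birth u v p τ * (a v * d)) + ∑[ u < n ] ∑[ v < n ] (born u v τ * (a v * d))
      ≡⟨ sym (trans (sum-cong-≗ λ u → ∑-distrib-+ (λ v → birth u v p τ * (a v * d)) (λ v → born u v τ * (a v * d)))
           (∑-distrib-+ (λ u → ∑[ v < n ] (birth u v p τ * (a v * d))) _)) ⟩
    ∑[ u < n ] ∑[ v < n ] (birth u v p τ * (a v * d) + born u v τ * (a v * d))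
      ≡⟨ sum-cong-≗ (λ u → sum-cong-≗ λ v → trans (sym (*-distribʳ-+ (a v * d) (birth u v p τ) (born u v τ)))
           (cong (_* (a v * d)) (sym (born-∷ p τ ok u v)))) ⟩
    ∑[ u < n ] ∑[ v < n ] (born u v (p ∷ τ) * (a v * d)) ∎
    where
    open ≤-Reasoning
    ok′ = admissible-tail p τ ok
    deg′ : ∀ v → ∑[ w < n ] born v w τ ≤ d
    deg′ v = ≤-trans (∑-mono λ w → born-mono p τ ok v w) (deg v)
    head : ∀ u v → birth u v p τ * (meetings u v τ * pending u v τ) ≤ birth u v p τ * (a v * d)
    head u v with u Fin.≟ v
    ... | yes refl rewrite birth-irrefl u p τ = z≤n
    ... | no u≢v = *-monoʳ-≤ (birth u v p τ) (*-mono-≤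
      (≤-trans (meetings≤incidences u v τ) (≤-trans (m≤n+m _ _) (inc v)))
      (≤-trans (pending≤codegree τ ok′ u≢v) (≤-trans (codegree≤degree u v τ) (deg′ v))))

  -- For each v there are at most d births of edges at v, each charged `a v * d`, and the incidences
  -- sum to twice the length.
  weighted-meetings≤ : ∀ d τ → Admissible τ → (∀ v → ∑[ w < n ] born v w τ ≤ d) →
    weighted meetings τ ≤ 2 * length τ * (d * d)
  weighted-meetings≤ d τ ok deg = begin
    weighted meetings τ
      ≤⟨ weighted≤∑-born a d τ ok deg (λ v → ≤-refl) ⟩
    ∑[ u < n ] ∑[ v < n ] (born u v τ * (a v * d))
      ≡⟨ ∑-comm (λ u v → born u v τ * (a v * d)) ⟩
    ∑[ v < n ] ∑[ u < n ] (born u v τ * (a v * d))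
      ≡⟨ sum-cong-≗ (λ v → trans (sum-cong-≗ λ u → cong (_* (a v * d)) (born-sym u v τ))
           (sym (*-distribʳ-sum (a v * d) (λ u → born v u τ)))) ⟩
    ∑[ v < n ] ((∑[ u < n ] born v u τ) * (a v * d))
      ≤⟨ ∑-mono (λ v → *-monoˡ-≤ (a v * d) (deg v)) ⟩
    ∑[ v < n ] (d * (a v * d))
      ≡⟨ sum-cong-≗ (λ v → rearrange d (a v)) ⟩
    ∑[ v < n ] (a v * (d * d))
      ≡⟨ sym (*-distribʳ-sum (d * d) a) ⟩
    sum a * (d * d)
      ≡⟨ cong (_* (d * d)) (∑-incidences τ) ⟩
    2 * length τ * (d * d) ∎
    where
    open ≤-Reasoning
    a : Fin n → ℕ
    a v = incidences v τ
    rearrange : ∀ d x → d * (x * d) ≡ x * (d * d)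
    rearrange = solve-∀

-- The edge sampler

m∣n! : ∀ {m n} .{{_ : NonZero m}} → m ≤ n → m ∣ n !
m∣n! {suc m} m≤n = ∣-trans (m∣m*n (m !)) (m≤n⇒m!∣n! m≤n)

module EdgeSampling (B n L : ℕ) {{L≢0 : NonZero L}} where

  open Triangles B n

  -- Divisible by 2 and by all m ≤ L, so that the residues of a coin are uniform.
  coins : ℕ
  coins = 2 * L !

  instance
    coins≢0 : NonZero coins
    coins≢0 = m*n≢0 2 (L !) {{_}} {{L !≢0}}

  -- The sampled edge is uv, and vw is the sample among the m later updates of
  -- edges at v other than uv. Until there is such an update, w is a dummy.
  record Sample : Set where
    constructor sample
    field
      u v w       : Fin n
      m s₁ s₂ s₃  : ℕ

  data Memory : Set where
    waiting : ℕ → Memory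
    active  : Sample → Memory

  orient : ℕ → Edge n → Fin n × Fin n
  orient zero    e = Edge.lo e , Edge.hi e
  orient (suc _) e = Edge.hi e , Edge.lo e

  launch : ℕ → Update n → Sample
  launch o p with u , v ← orient o (proj₁ p) = sample u v u 0 (shift 0 (increment u v p)) 0 0

  -- The trackers of uv and vw absorb, as these edges must have been born at the sampled updates;
  -- that of uw reflects, as its birth has to come later.
  keep : ℕ → Update n → Sample → Sample
  keep m′ p (sample u v w m s₁ s₂ s₃) =
    sample u v w m′ (absorb s₁ (increment u v p)) (absorb s₂ (increment v w p)) (shift s₃ (increment u w p))

  -- The second tracker already includes `p`, its possible birth; the third starts at 0 after `p`.
  replace : ℕ → Fin n → Update n → Sample → Sample
  replace m′ w′ p (sample u v w m s₁ s₂ s₃) =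
    sample u v w′ m′ (absorb s₁ (increment u v p)) (shift 0 (increment v w′ p)) 0

  reservoir : ℕ → ℕ → Fin n → Update n → Sample → Sample
  reservoir zero    = replace
  reservoir (suc _) m′ w′ = keep m′

  advance : Fin coins → Maybe (Fin n) → Update n → Sample → Sample
  advance r nothing   p x = keep (Sample.m x) p x
  -- The cap at `L` can only act on streams longer than `L`; it keeps the counter within its bits on
  -- every reachable memory.
  advance r (just w′) p x = reservoir (toℕ r % suc (Sample.m x)) (suc (Sample.m x) ⊓ L) w′ p x

  step : Fin coins → Update n → Memory → Memory
  step r p (waiting zero)    = active (launch (toℕ r % 2) p)
  step r p (waiting (suc k)) = waiting k
  step r p (active x)        = active (advance r (far (Sample.u x) (Sample.v x) (proj₁ p)) p x)

  -- `g` is constantly 1 for the estimate and `id` for its square: indicators are idempotent, so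
  -- squaring adds just one more factor `m`, up to scaling.
  payoff : (ℕ → ℕ) → Memory → ℕ
  payoff g (waiting _)                     = 0
  payoff g (active (sample _ _ _ m s₁ s₂ s₃)) = g m * (m * (isOne s₁ * isOne s₂ * isOne s₃))

  sampler : Sampler n
  sampler = record
    { Memory = Memory
    ; coins  = coins
    ; init   = λ r → waiting (toℕ r % L)
    ; step   = step
    ; value  = λ x → 2 * L * payoff (λ _ → 1) x
    }

  ∑-coins : ∀ m .{{_ : NonZero m}} → m ∣ coins → (f : ℕ → ℕ) →
            m * ∑[ r < coins ] f (toℕ r % m) ≡ coins * ∑[ j < m ] f (toℕ j)
  ∑-coins m (divides q eq) f = begin-equality
    m * ∑[ r < coins ] f (toℕ r % m)
      ≡⟨ cong (λ N → m * ∑[ r < N ] f (toℕ r % m)) eq ⟩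
    m * ∑[ r < q * m ] f (toℕ r % m)
      ≡⟨ cong (m *_) (∑-% q m f) ⟩
    m * (q * ∑[ j < m ] f (toℕ j))
      ≡⟨ trans (sym (*-assoc m q _)) (cong (_* ∑[ j < m ] f (toℕ j)) (trans (*-comm m q) (sym eq))) ⟩
    coins * ∑[ j < m ] f (toℕ j) ∎
    where open ≤-Reasoning

  -- A birth at `p` needs `p` to join v and w. The only possible w is u, and then uw is degenerate.
  ∑-birth-misses : ∀ {u v} p τ → (∀ {w} → Joins v w (proj₁ p) → w ≡ u) →
                   ∑[ w < n ] (birth v w p τ * born u w τ) ≡ 0
  ∑-birth-misses {u} {v} p τ only = ∑-zero term
    where
    term : ∀ w → birth v w p τ * born u w τ ≡ 0
    term w with joins? v w (proj₁ p)
    ... | no ¬j = cong (_* born u w τ) (birth-∦ p τ ¬j)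
    ... | yes j = trans (cong (λ w → birth v w p τ * born u w τ) (only j))
      (trans (cong (birth v u p τ *_) (born-irrefl u τ)) (*-zeroʳ (birth v u p τ)))

  ∑-birth-meets : ∀ {u v w} p τ → Joins v w (proj₁ p) →
                  ∑[ w < n ] (birth v w p τ * born u w τ) ≡ birth v w p τ * born u w τ
  ∑-birth-meets {u} {v} {w} p τ j = ∑-single (λ w → birth v w p τ * born u w τ) w λ i i≢w →
    cong (_* born u i τ) (birth-∦ p τ λ j′ → i≢w (joins-other {e = proj₁ p} (joins-sym {e = proj₁ p} j′) j))

  module _ (g : ℕ → ℕ) where

    -- The conditional expectation of the payoff. Each candidate for w becomes the final sample with
    -- probability 1 over the final count, which the factor `m` of the payoff cancels. The present
    -- sample stands for the `m` candidates so far, `pending` for those to come.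
    expected : Sample → List (Update n) → ℕ
    expected (sample u v w m s₁ s₂ s₃) τ =
      g (m + meetings u v τ) *
        (absorbed s₁ (increments u v τ) *
          (m * (absorbed s₂ (increments v w τ) * reflected s₃ (increments u w τ)) + pending u v τ))

    -- The bound ensures that `m + 1` is at most `L` whenever the reservoir draws, so that the cap
    -- does not act and the residues are uniform.
    total-active : ∀ τ x → Sample.m x + meetings (Sample.u x) (Sample.v x) τ ≤ L →
                   total step τ (payoff g) (active x) ≡ coins ^ length τ * expected x τ
    -- The new candidate is taken with probability 1/(m+1) and then stands for m+1 candidates;
    -- otherwise the old sample does so. On average they count 1 and m times, as `expected`
    -- predicts. The result `y` of `far` is a variable so that its view can be matched on.
    total-advance : ∀ p τ (x : Sample) → let open Sample x in
      ∀ y → Far u v (proj₁ p) y → m + (meeting y + meetings u v τ) ≤ L →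
      ∑[ r < coins ] total step τ (payoff g) (active (advance r y p x)) ≡
      coins * coins ^ length τ *
        (g (m + (meeting y + meetings u v τ)) *
          (absorbed s₁ (increments u v (p ∷ τ)) *
            (m * (absorbed s₂ (increments v w (p ∷ τ)) * reflected s₃ (increments u w (p ∷ τ))) + pending u v (p ∷ τ))))

    total-active [] (sample u v w m s₁ s₂ s₃) _ rewrite +-identityʳ m = arith (g m) m (isOne s₁) (isOne s₂) (isOne s₃)
      where
      arith : ∀ g m x y z → g * (m * (x * y * z)) ≡ 1 * (g * (x * (m * (y * z) + 0)))
      arith = solve-∀
    total-active (p ∷ τ) x@(sample u v w m s₁ s₂ s₃) bound =
      total-advance p τ x (far u v (proj₁ p)) (far-view u v (proj₁ p)) bound

    total-advance p τ x@(sample u v w m s₁ s₂ s₃) nothing (misses only) bound = begin-equality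
      ∑[ r < coins ] total step τ (payoff g) (active (keep m p x))
        ≡⟨ ∑-const coins _ ⟩
      coins * total step τ (payoff g) (active (keep m p x))
        ≡⟨ cong (coins *_) (total-active τ (keep m p x) bound) ⟩
      coins * (coins ^ length τ * expected (keep m p x) τ)
        ≡⟨ sym (*-assoc coins (coins ^ length τ) _) ⟩
      coins * coins ^ length τ * expected (keep m p x) τ
        ≡⟨ cong (λ h → coins * coins ^ length τ * (g (m + meetings u v τ) *
             (absorbed s₁ (increments u v (p ∷ τ)) *
               (m * (absorbed s₂ (increments v w (p ∷ τ)) * reflected s₃ (increments u w (p ∷ τ))) + (h + pending u v τ)))))
             (sym (∑-birth-misses p τ only)) ⟩
      _ ∎
      where open ≤-Reasoning
    total-advance p τ x@(sample u v w m s₁ s₂ s₃) (just w′) (meets j _) bound = *-cancelˡ-≡ _ _ (suc m) (begin-equality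
      suc m * ∑[ r < coins ] f (toℕ r % suc m)
        ≡⟨ ∑-coins (suc m) (∣-trans (m∣n! m<L) (n∣m*n 2)) f ⟩
      coins * (f 0 + ∑[ i < m ] f (suc (toℕ i)))
        -- `reservoir` treats all non-zero residues alike, so `f 1` stands for each of them.
        ≡⟨ cong (λ y → coins * (f 0 + y)) (∑-const m (f 1)) ⟩
      coins * (f 0 + m * f 1)
        ≡⟨ cong (coins *_) (cong₂ (λ y z → y + m * z) (total-active τ (replace (suc m ⊓ L) w′ p x) bound′)
                                                      (total-active τ (keep (suc m ⊓ L) p x) bound′)) ⟩
      coins * (M * expected (replace (suc m ⊓ L) w′ p x) τ + m * (M * expected (keep (suc m ⊓ L) p x) τ))
        ≡⟨ cong (λ m′ → coins * (M * expected (replace m′ w′ p x) τ + m * (M * expected (keep m′ p x) τ))) (m≤n⇒m⊓n≡m m<L) ⟩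
      coins * (M * expected (replace (suc m) w′ p x) τ + m * (M * expected (keep (suc m) p x) τ))
        ≡⟨ cong (λ k → coins * (M * (g k * (a * (suc m * (birth v w′ p τ * born u w′ τ) + pending u v τ))) +
             m * (M * (g k * (a * (suc m * (b * c) + pending u v τ)))))) (sym (+-suc m (meetings u v τ))) ⟩
      coins * (M * (g (m + suc (meetings u v τ)) * (a * (suc m * (birth v w′ p τ * born u w′ τ) + pending u v τ))) +
          m * (M * (g (m + suc (meetings u v τ)) * (a * (suc m * (b * c) + pending u v τ)))))
        ≡⟨ arith coins M (g (m + suc (meetings u v τ))) a m (birth v w′ p τ * born u w′ τ) (pending u v τ) (b * c) ⟩
      suc m * (coins * M * (g (m + suc (meetings u v τ)) * (a * (m * (b * c) + (birth v w′ p τ * born u w′ τ + pending u v τ)))))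
        ≡⟨ cong (λ h → suc m * (coins * M * (g (m + suc (meetings u v τ)) * (a * (m * (b * c) + (h + pending u v τ))))))
             (sym (∑-birth-meets p τ j)) ⟩
      _ ∎)
      where
      open ≤-Reasoning
      M = coins ^ length τ
      a = absorbed s₁ (increments u v (p ∷ τ))
      b = absorbed s₂ (increments v w (p ∷ τ))
      c = reflected s₃ (increments u w (p ∷ τ))
      f : ℕ → ℕ
      f i = total step τ (payoff g) (active (reservoir i (suc m ⊓ L) w′ p x))
      bound″ : suc m + meetings u v τ ≤ L
      bound″ = ≤-trans (≤-reflexive (sym (+-suc m _))) bound
      m<L : suc m ≤ L
      m<L = ≤-trans (m≤m+n (suc m) _) bound″
      bound′ : suc m ⊓ L + meetings u v τ ≤ L
      bound′ = ≤-trans (+-monoˡ-≤ (meetings u v τ) (m⊓n≤m (suc m) L)) bound″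
      arith : ∀ C M g a m x h y → C * (M * (g * (a * ((1 + m) * x + h))) + m * (M * (g * (a * ((1 + m) * y + h))))) ≡
              (1 + m) * (C * M * (g * (a * (m * y + (x + h)))))
      arith = solve-∀

    weight : Fin n → Fin n → List (Update n) → ℕ
    weight u v τ = g (meetings u v τ)

    total-launch : ∀ o p τ → length τ ≤ L → let u , v = orient o (proj₁ p) in
      total step τ (payoff g) (active (launch o p)) ≡ coins ^ length τ * (birth u v p τ * (weight u v τ * pending u v τ))
    total-launch o p τ len = trans
      (total-active τ (launch o p) (≤-trans (meetings≤length _ _ τ) len))
      (cong (coins ^ length τ *_) (swap (weight _ _ τ) (birth _ _ p τ) (pending _ _ τ)))
      where
      swap : ∀ x y z → x * (y * z) ≡ y * (x * z)
      swap = solve-∀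

    -- Summing over the waiting time sums over the position of the sampled edge.
    ∑-total-waiting : ∀ τ → length τ ≤ L →
      2 * ∑[ k < length τ ] total step τ (payoff g) (waiting (toℕ k)) ≡ coins ^ length τ * weighted weight τ
    ∑-total-waiting []      len = refl
    ∑-total-waiting (p ∷ τ) len = begin-equality
      2 * (∑[ r < coins ] first (toℕ r % 2) + ∑[ k < l ] ∑[ r < coins ] rest k)
        ≡⟨ *-distribˡ-+ 2 (∑[ r < coins ] first (toℕ r % 2)) _ ⟩
      2 * ∑[ r < coins ] first (toℕ r % 2) + 2 * ∑[ k < l ] ∑[ r < coins ] rest k
        ≡⟨ cong₂ _+_ (∑-coins 2 (m∣m*n (L !)) first)
             (cong (2 *_) (trans (sum-cong-≗ λ k → ∑-const coins (rest k)) (sym (*-distribˡ-sum coins rest)))) ⟩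
      coins * (first 0 + (first 1 + 0)) + 2 * (coins * sum rest)
        ≡⟨ cong₂ (λ x y → coins * x + y) (cong₂ _+_ (total-launch 0 p τ (<⇒≤ len))
             (trans (+-identityʳ (first 1)) (total-launch 1 p τ (<⇒≤ len)))) (swap coins (sum rest)) ⟩
      coins * (M * F a b + M * F b a) + coins * (2 * sum rest)
        ≡⟨ cong₂ (λ x y → coins * x + coins * y) (sym (*-distribˡ-+ M (F a b) (F b a))) (∑-total-waiting τ (<⇒≤ len)) ⟩
      coins * (M * (F a b + F b a)) + coins * (M * weighted weight τ)
        -- Only the two orientations of the edge of `p` can have a birth at `p`, so they make up the
        -- whole double sum.
        ≡⟨ cong (λ x → coins * (M * x) + coins * (M * weighted weight τ))
             (sym (∑-joins (proj₁ p) F λ u v ¬j → cong (_* (weight u v τ * pending u v τ)) (birth-∦ p τ ¬j))) ⟩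
      coins * (M * S) + coins * (M * weighted weight τ)
        ≡⟨ collect coins M S (weighted weight τ) ⟩
      coins * M * (S + weighted weight τ) ∎
      where
      open ≤-Reasoning
      l = length τ
      M = coins ^ l
      a = Edge.lo (proj₁ p)
      b = Edge.hi (proj₁ p)
      first : ℕ → ℕ
      first o = total step τ (payoff g) (active (launch o p))
      rest : Fin l → ℕ
      rest k = total step τ (payoff g) (waiting (toℕ k))
      F : Fin n → Fin n → ℕ
      F u v = birth u v p τ * (weight u v τ * pending u v τ)
      S = ∑[ u < n ] ∑[ v < n ] F u v
      swap : ∀ C x → 2 * (C * x) ≡ C * (2 * x)
      swap = solve-∀
      collect : ∀ C M x y → C * (M * x) + C * (M * y) ≡ C * M * (x + y)
      collect = solve-∀

    -- `2 * L` is the inverse probability of a given position and orientation of the first edge.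
    runs-payoff : ∀ σ → length σ ≡ L →
      2 * L * Sampler.runs sampler σ (payoff g) ≡ Sampler.outcomes sampler σ * weighted weight σ
    runs-payoff σ refl = begin-equality
      2 * L * ∑[ r < coins ] wait (toℕ r % L)
        ≡⟨ *-assoc 2 L _ ⟩
      2 * (L * ∑[ r < coins ] wait (toℕ r % L))
        ≡⟨ cong (2 *_) (∑-coins L (∣-trans (m∣n! ≤-refl) (n∣m*n 2)) wait) ⟩
      2 * (coins * ∑[ k < L ] wait (toℕ k))
        ≡⟨ swap coins _ ⟩
      coins * (2 * ∑[ k < L ] wait (toℕ k))
        ≡⟨ cong (coins *_) (∑-total-waiting σ ≤-refl) ⟩
      coins * (coins ^ L * weighted weight σ)
        ≡⟨ sym (*-assoc coins _ _) ⟩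
      coins * coins ^ L * weighted weight σ ∎
      where
      open ≤-Reasoning
      wait : ℕ → ℕ
      wait k = total step σ (payoff g) (waiting k)
      swap : ∀ C x → 2 * (C * x) ≡ C * (2 * x)
      swap = solve-∀

  square-payoff : ∀ x → 2 * L * payoff (λ _ → 1) x * (2 * L * payoff (λ _ → 1) x) ≡ 2 * L * (2 * L * payoff id x)
  square-payoff (waiting _) rewrite *-zeroʳ (2 * L) = sym (*-zeroʳ (2 * L))
  square-payoff (active (sample _ _ _ m s₁ s₂ s₃)) =
    trans (arith (2 * L) m (isOne s₁) (isOne s₂) (isOne s₃))
      (cong (λ z → 2 * L * (2 * L * (m * (m * z)))) (cong₂ _*_ (cong₂ _*_ (idem s₁) (idem s₂)) (idem s₃)))
    where
    arith : ∀ l m x y z → l * (1 * (m * (x * y * z))) * (l * (1 * (m * (x * y * z)))) ≡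
                          l * (l * (m * (m * (x * x * (y * y) * (z * z)))))
    arith = solve-∀
    idem : ∀ s → isOne s * isOne s ≡ isOne s
    idem 0             = refl
    idem 1             = refl
    idem (suc (suc _)) = refl

  sampler-moments : ∀ d σ → length σ ≡ L → Admissible σ → (∀ v → ∑[ w < n ] born v w σ ≤ d) →
    Sampler.Moments sampler σ (weighted (λ _ _ _ → 1) σ) (4 * (L * L * (d * d)))
  sampler-moments d σ len ok deg = record
    { first  = trans (Sampler.runs-* sampler σ (2 * L) _) (runs-payoff (λ _ → 1) σ len)
    ; second = begin
        runs σ (λ x → 2 * L * payoff (λ _ → 1) x * (2 * L * payoff (λ _ → 1) x))
          ≡⟨ trans (runs-cong σ square-payoff) (trans (runs-* σ (2 * L) _) (cong (2 * L *_) (runs-* σ (2 * L) _))) ⟩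
        2 * L * (2 * L * runs σ (payoff id))
          ≡⟨ cong (2 * L *_) (runs-payoff id σ len) ⟩
        2 * L * (outcomes σ * weighted meetings σ)
          ≤⟨ *-monoʳ-≤ (2 * L) (*-monoʳ-≤ (outcomes σ) (SecondMoment.weighted-meetings≤ B n d σ ok deg)) ⟩
        2 * L * (outcomes σ * (2 * length σ * (d * d)))
          ≡⟨ cong (λ l → 2 * L * (outcomes σ * (2 * l * (d * d)))) len ⟩
        2 * L * (outcomes σ * (2 * L * (d * d)))
          ≡⟨ arith L (outcomes σ) (d * d) ⟩
        outcomes σ * (4 * (L * L * (d * d))) ∎
    }
    where
    open ≤-Reasoning
    open Sampler sampler using (runs; outcomes; runs-cong; runs-*)
    arith : ∀ L N d → 2 * L * (N * (2 * L * d)) ≡ N * (4 * (L * L * d))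
    arith = solve-∀

-- Encodings

-- As in `UsesBits`, injectivity is demanded only on a subset, here described by an invariant.
Code : {A : Set} → (A → Set) → ℕ → Set
Code {A} P s = Σ[ encode ∈ (A → Vec Bool s) ] (∀ {x y} → P x → P y → encode x ≡ encode y → x ≡ y)

code-⊤ : Code {⊤} (λ _ → ⊤) 0
code-⊤ = (λ _ → []) , λ _ _ _ → refl

code-map : ∀ {A B : Set} {P : A → Set} {Q : B → Set} {s} (f : A → B) → (∀ {x y} → f x ≡ f y → x ≡ y) →
           (∀ {x} → P x → Q (f x)) → Code Q s → Code P s
code-map f f-injective P⇒Q (encode , injective) =
  encode ∘ f , λ px py eq → f-injective (injective (P⇒Q px) (P⇒Q py) eq)

code-× : ∀ {A B : Set} {P : A → Set} {Q : B → Set} {s t} → Code P s → Code Q t →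
         Code {A × B} (λ (x , y) → P x × Q y) (s + t)
code-× (f , f-injective) (g , g-injective) =
  (λ (x , y) → f x Vec.++ g y) , λ (px , qx) (py , qy) eq →
    let eq₁ , eq₂ = ++-injective _ _ eq in cong₂ _,_ (f-injective px py eq₁) (g-injective qx qy eq₂)

-- Each side is padded by the room of the other; compared with the maximum of the lengths this costs
-- at most a factor 2.
code-⊎ : ∀ {A B : Set} {P : A → Set} {Q : B → Set} {s t} → Code P s → Code Q t →
         Code {A ⊎ B} [ P , Q ] (suc (s + t))
code-⊎ {A} {B} {P} {Q} {s} {t} (f , f-injective) (g , g-injective) = encode , λ {x} {y} → injective x y
  where
  encode : A ⊎ B → Vec Bool (suc (s + t))
  encode (inj₁ x) = false ∷ f x Vec.++ Vec.replicate t false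
  encode (inj₂ y) = true ∷ Vec.replicate s false Vec.++ g y
  injective : ∀ x y → [ P , Q ] x → [ P , Q ] y → encode x ≡ encode y → x ≡ y
  injective (inj₁ x) (inj₁ y) px py eq = cong inj₁ (f-injective px py (proj₁ (++-injective _ _ (proj₂ (∷-injective eq)))))
  injective (inj₂ x) (inj₂ y) px py eq = cong inj₂ (g-injective px py (proj₂ (++-injective _ _ (proj₂ (∷-injective eq)))))
  injective (inj₁ x) (inj₂ y) px py ()
  injective (inj₂ x) (inj₁ y) px py ()

binary : ∀ s → ℕ → Vec Bool s
binary zero    x = []
binary (suc s) x with x <? 2 ^ s
... | yes _ = false ∷ binary s x
... | no  _ = true ∷ binary s (x ∸ 2 ^ s)

binary-injective : ∀ s {x y} → x < 2 ^ s → y < 2 ^ s → binary s x ≡ binary s y → x ≡ y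
binary-injective zero    x<1 y<1 _ = trans (n<1⇒n≡0 x<1) (sym (n<1⇒n≡0 y<1))
binary-injective (suc s) {x} {y} x< y< eq with x <? 2 ^ s | y <? 2 ^ s
... | yes x<′ | yes y<′ = binary-injective s x<′ y<′ (proj₂ (∷-injective eq))
... | no  x≮  | no  y≮  = ∸-cancelʳ-≡ (≮⇒≥ x≮) (≮⇒≥ y≮)
  (binary-injective s (half (≮⇒≥ x≮) x<) (half (≮⇒≥ y≮) y<) (proj₂ (∷-injective eq)))
  where
  half : ∀ {x} → 2 ^ s ≤ x → x < 2 * 2 ^ s → x ∸ 2 ^ s < 2 ^ s
  half {x} p q = +-cancelʳ-< (2 ^ s) (x ∸ 2 ^ s) (2 ^ s)
    (≤-trans (≤-reflexive (cong suc (m∸n+n≡m p))) (≤-trans q (≤-reflexive (cong (2 ^ s +_) (+-identityʳ (2 ^ s))))))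
... | yes _ | no _ with () ← proj₁ (∷-injective eq)
... | no _ | yes _ with () ← proj₁ (∷-injective eq)

code-ℕ : ∀ {b} s → b < 2 ^ s → Code (_≤ b) s
code-ℕ s b< = binary s , λ x≤b y≤b → binary-injective s (≤-<-trans x≤b b<) (≤-<-trans y≤b b<)

code-Fin : ∀ {n} s → n ≤ 2 ^ s → Code {Fin n} (λ _ → ⊤) s
code-Fin s n≤ = binary s ∘ toℕ , λ {x} {y} _ _ eq →
  Fin.toℕ-injective (binary-injective s (<-≤-trans (Fin.toℕ<n x) n≤) (<-≤-trans (Fin.toℕ<n y) n≤) eq)

code-ℤ : ∀ {b} s → b < 2 ^ s → Code (λ z → ℤ.∣ z ∣ ≤ b) (suc (s + s))
code-ℤ {b} s b< = code-map split (λ {x} {y} → split-injective x y) (λ {x} → bound x) (code-⊎ (code-ℕ s b<) (code-ℕ s b<))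
  where
  split : ℤ → ℕ ⊎ ℕ
  split (ℤ.+ x)  = inj₁ x
  split -[1+ x ] = inj₂ x
  split-injective : ∀ x y → split x ≡ split y → x ≡ y
  split-injective (ℤ.+ x)  (ℤ.+ x)  refl = refl
  split-injective -[1+ x ] -[1+ x ] refl = refl
  bound : ∀ z → ℤ.∣ z ∣ ≤ b → [ _≤ b , _≤ b ] (split z)
  bound (ℤ.+ x)  p = p
  bound -[1+ x ] p = <⇒≤ p

code-Edge : ∀ {n} s → n ≤ 2 ^ s → Code {Edge n} (λ _ → ⊤) (s + s)
code-Edge s n≤ = code-map (λ e → Edge.lo e , Edge.hi e) (λ { refl → refl }) (λ _ → tt , tt)
  (code-× (code-Fin s n≤) (code-Fin s n≤))

-- The extra bit per slot tells whether the slot is filled.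
code-List : ∀ {A : Set} {P : A → Set} {s} → Code P s → ∀ l →
            Code {List A} (λ xs → length xs ≤ l × All P xs) (l * suc s)
code-List {A} {P} {s} (f , f-injective) l = encode l , λ {xs} {ys} (lx , px) (ly , py) → injective l xs ys lx ly px py
  where
  encode : ∀ l → List A → Vec Bool (l * suc s)
  encode zero    xs       = []
  encode (suc l) []       = (false ∷ Vec.replicate s false) Vec.++ encode l []
  encode (suc l) (x ∷ xs) = (true ∷ f x) Vec.++ encode l xs
  injective : ∀ l xs ys → length xs ≤ l → length ys ≤ l → All P xs → All P ys → encode l xs ≡ encode l ys → xs ≡ ys
  injective zero    [] [] _ _ _ _ _ = refl
  injective (suc l) [] [] _ _ _ _ _ = refl
  injective (suc l) (x ∷ xs) (y ∷ ys) (s≤s lx) (s≤s ly) (p ∷ ps) (q ∷ qs) eq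
    with eq₁ , eq₂ ← ++-injective (true ∷ f x) (true ∷ f y) eq =
    cong₂ _∷_ (f-injective p q (proj₂ (∷-injective eq₁))) (injective l xs ys lx ly ps qs eq₂)

record Compact {n : ℕ} (A : Sampler n) (s : ℕ) : Set₁ where
  open Sampler A
  field
    Invariant : Memory → Set
    initially : ∀ r → Invariant (init r)
    preserved : ∀ r p {x} → Invariant x → Invariant (step r p x)
    code      : Code Invariant s

module _ where

  open Compact

  copies-compact : ∀ {n} k {A : Sampler n} {s} → Compact A s → Compact (copies k A) (k * s)
  copies-compact zero    c = record
    { Invariant = λ _ → ⊤ ; initially = λ _ → tt ; preserved = λ _ _ _ → tt ; code = code-⊤ }
  copies-compact (suc k) c = record
    { Invariant = λ (x , y) → Invariant c x × Invariant cs y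
    ; initially = λ r → initially c _ , initially cs _
    ; preserved = λ r p (i , is) → preserved c _ p i , preserved cs _ p is
    ; code      = code-× (code c) (code cs)
    }
    where cs = copies-compact k c

module _ (B n L : ℕ) {{L≢0 : NonZero L}} where

  open EdgeSampling B n L
  open Triangles B n using (shift≤B; absorb≤B)

  Bounded : Sample → Set
  Bounded x = m ≤ L × s₁ ≤ B × s₂ ≤ B × s₃ ≤ B
    where open Sample x

  reservoir-bounded : ∀ i m′ w p x → m′ ≤ L → Bounded x → Bounded (reservoir i m′ w p x)
  reservoir-bounded zero    m′ w p (sample u v _ m s₁ s₂ s₃) m′≤L _ =
    m′≤L , absorb≤B s₁ (increment u v p) , shift≤B 0 (increment v w p) , z≤n
  reservoir-bounded (suc i) m′ w′ p (sample u v w m s₁ s₂ s₃) m′≤L _ =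
    m′≤L , absorb≤B s₁ (increment u v p) , absorb≤B s₂ (increment v w p) , shift≤B s₃ (increment u w p)

  advance-bounded : ∀ r y p x → Bounded x → Bounded (advance r y p x)
  advance-bounded r nothing  p (sample u v w m s₁ s₂ s₃) (m≤L , _) =
    m≤L , absorb≤B s₁ (increment u v p) , absorb≤B s₂ (increment v w p) , shift≤B s₃ (increment u w p)
  advance-bounded r (just w) p x b = reservoir-bounded (toℕ r % suc (Sample.m x)) _ w p x (m⊓n≤n (suc (Sample.m x)) L) b

  sampler-compact : ∀ a b e → n ≤ 2 ^ a → L < 2 ^ b → B < 2 ^ e →
                    Compact sampler (suc (b + (a + (a + (a + (b + (e + (e + e))))))))
  sampler-compact a b e n≤ L< B< = record
    { Invariant = λ x → [ _≤ L , Bounded ] (unpack x)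
    ; initially = λ r → <⇒≤ (m%n<n (toℕ r) L)
    ; preserved = λ r p {x} → bounded r p x
    ; code      = code-map unpack (λ {x} {y} → unpack-injective x y) id
        (code-⊎ (code-ℕ b L<) (code-map
          (λ (sample u v w m s₁ s₂ s₃) → u , v , w , m , s₁ , s₂ , s₃) (λ { refl → refl })
          (λ (p , q , r , s) → tt , tt , tt , p , q , r , s)
          (code-× (code-Fin a n≤) (code-× (code-Fin a n≤) (code-× (code-Fin a n≤)
            (code-× (code-ℕ b L<) (code-× (code-ℕ e B<) (code-× (code-ℕ e B<) (code-ℕ e B<)))))))))
    }
    where
    unpack : Memory → ℕ ⊎ Sample
    unpack (waiting k) = inj₁ k
    unpack (active x)  = inj₂ x
    unpack-injective : ∀ x y → unpack x ≡ unpack y → x ≡ y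
    unpack-injective (waiting _) (waiting _) refl = refl
    unpack-injective (active _)  (active _)  refl = refl
    bounded : ∀ r p x → [ _≤ L , Bounded ] (unpack x) → [ _≤ L , Bounded ] (unpack (step r p x))
    bounded r p (waiting zero)    _   = z≤n , shift≤B 0 (increment _ _ p) , z≤n , z≤n
    bounded r p (waiting (suc k)) k<L = <⇒≤ k<L
    bounded r p (active x)        b   = advance-bounded r (far (Sample.u x) (Sample.v x) (proj₁ p)) p x b

-- Valid streams

total-displacement : List ℤ → ℤ
total-displacement = foldr ℤ._+_ 0ℤ

module _ (B : ℕ) where

  open Tracker B

  shift-exact : ∀ {x y} z → ℤ.+ y ≡ ℤ.+ x ℤ.+ z → y ≤ B → shift x z ≡ y
  shift-exact {x} {y} (ℤ.+ a) eq y≤B = trans (cong (_⊓ B) (sym (ℤ.+-injective eq))) (m≤n⇒m⊓n≡m y≤B)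
  shift-exact {x} {y} -[1+ a ] eq y≤B = trans (cong (_⊓ B) difference) (m≤n⇒m⊓n≡m y≤B)
    where
    restore : y + suc a ≡ x
    restore = ℤ.+-injective (trans (cong (ℤ._+ ℤ.+ suc a) eq)
      (trans (ℤ.+-assoc (ℤ.+ x) -[1+ a ] (ℤ.+ suc a))
        (trans (cong (λ z → ℤ.+ x ℤ.+ z) (ℤ.+-inverseˡ (ℤ.+ suc a))) (ℤ.+-identityʳ (ℤ.+ x)))))
    difference : x ∸ suc a ≡ y
    difference = trans (cong (_∸ suc a) (sym restore)) (m+n∸n≡m y (suc a))

  prefixes-Walk : ∀ zs x →
    (∀ t → t ≤ length zs → ∃[ y ] ℤ.+ y ≡ ℤ.+ x ℤ.+ total-displacement (take t zs) × y ≤ B) →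
    (∃[ y ] ℤ.+ y ≡ ℤ.+ x ℤ.+ total-displacement zs × y ≤ 1) → Walk x zs
  prefixes-Walk []       x inside (y , eq , y≤1) =
    ≤-trans (≤-reflexive (sym (ℤ.+-injective (trans eq (ℤ.+-identityʳ (ℤ.+ x)))))) y≤1
  prefixes-Walk (z ∷ zs) x inside (y , eq , y≤1) with y₁ , eq₁ , y₁≤B ← inside 1 (s≤s z≤n) =
    exact , prefixes-Walk zs (shift x z)
      (λ t t≤ → let y , eq , y≤B = inside (suc t) (s≤s t≤) in y , trans eq (reassociate (take t zs)) , y≤B)
      (y , trans eq (reassociate zs) , y≤1)
    where
    eq₁′ : ℤ.+ y₁ ≡ ℤ.+ x ℤ.+ z
    eq₁′ = trans eq₁ (cong (λ w → ℤ.+ x ℤ.+ w) (ℤ.+-identityʳ z))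
    exact : ℤ.+ shift x z ≡ ℤ.+ x ℤ.+ z
    exact = trans (cong ℤ.+_ (shift-exact z eq₁′ y₁≤B)) eq₁′
    reassociate : ∀ ws → ℤ.+ x ℤ.+ (z ℤ.+ total-displacement ws) ≡ ℤ.+ shift x z ℤ.+ total-displacement ws
    reassociate ws = trans (sym (ℤ.+-assoc (ℤ.+ x) z _)) (cong (ℤ._+ total-displacement ws) (sym exact))

length-filter-tabulate : ∀ {A : Set} {P : A → Set} (P? : Decidable P) {n} (f : Fin n → A) →
  length (filter P? (tabulate f)) ≡ ∑[ i < n ] indicator (P? (f i))
length-filter-tabulate P? {zero}  f = refl
length-filter-tabulate P? {suc n} f with does (P? (f zero))
... | true  = cong suc (length-filter-tabulate P? (f ∘ suc))
... | false = length-filter-tabulate P? (f ∘ suc)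

length-filter-map : ∀ {A B : Set} {P : B → Set} (P? : Decidable P) (f : A → B) xs →
  length (filter P? (map f xs)) ≡ length (filter (P? ∘ f) xs)
length-filter-map P? f []       = refl
length-filter-map P? f (x ∷ xs) with does (P? (f x))
... | true  = cong suc (length-filter-map P? f xs)
... | false = length-filter-map P? f xs

length-filter-cartesianProductWith : ∀ {A B C : Set} {P : C → Set} (P? : Decidable P) (g : A → B → C) {n} (f : Fin n → A) ys →
  length (filter P? (cartesianProductWith g (tabulate f) ys)) ≡ ∑[ i < n ] length (filter (λ y → P? (g (f i) y)) ys)
length-filter-cartesianProductWith P? g {zero}  f ys = refl
length-filter-cartesianProductWith P? g {suc n} f ys =
  trans (cong length (filter-++ P? (map (g (f zero)) ys) _))
    (trans (length-++ (filter P? (map (g (f zero)) ys)))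
      (cong₂ _+_ (length-filter-map P? (g (f zero)) ys) (length-filter-cartesianProductWith P? g (f ∘ suc) ys)))

indicator-× : ∀ {P Q : Set} (P? : Dec P) (Q? : Dec Q) → indicator (P? ×-dec Q?) ≡ indicator P? * indicator Q?
indicator-× P? Q? with does P?
... | true  = sym (+-identityʳ _)
... | false = refl

indicator-unique : ∀ {P : Set} (P? : Dec P) {b} → (P → b ≡ 1) → (¬ P → b ≡ 0) → indicator P? ≡ b
indicator-unique (yes p) b≡1 _   = sym (b≡1 p)
indicator-unique (no ¬p) _   b≡0 = sym (b≡0 ¬p)

joins-edge : ∀ {n} {u v : Fin n} .(u<v : u Fin.< v) e → Joins u v e → e ≡ edge u v u<v
joins-edge u<v (edge a b a<b) (inj₁ (refl , refl)) = refl
joins-edge u<v (edge a b a<b) (inj₂ (refl , refl)) = ⊥-elim-irr (<-asym a<b u<v)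

-- `stateAt` drops the updates of other edges, whereas `increments` keeps them as zeros.
displacement-filter : ∀ {n} {u v : Fin n} .(u<v : u Fin.< v) (τ : List (Update n)) →
  total-displacement (map proj₂ (filter (λ p → proj₁ p ≟ᴱ edge u v u<v) τ)) ≡ total-displacement (increments u v τ)
displacement-filter u<v [] = refl
displacement-filter {n} {u} {v} u<v (p@(e , Δ) ∷ τ) = by-cases (e ≟ᴱ edge u v u<v)
  where
  open ≡-Reasoning
  same : Update n → Set
  same q = proj₁ q ≡ edge u v u<v
  same? : Decidable same
  same? q = proj₁ q ≟ᴱ edge u v u<v
  by-cases : Dec (same p) → total-displacement (map proj₂ (filter same? (p ∷ τ))) ≡ total-displacement (increments u v (p ∷ τ))
  by-cases (yes e≡) = begin
    total-displacement (map proj₂ (filter same? (p ∷ τ)))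
      ≡⟨ cong (total-displacement ∘ map proj₂) (filter-accept same? e≡) ⟩
    Δ ℤ.+ total-displacement (map proj₂ (filter same? τ))
      ≡⟨ cong₂ ℤ._+_ (sym (increment-∥ {u = u} {v} p (inj₁ (cong Edge.lo e≡ , cong Edge.hi e≡)))) (displacement-filter u<v τ) ⟩
    total-displacement (increments u v (p ∷ τ)) ∎
  by-cases (no e≢) = begin
    total-displacement (map proj₂ (filter same? (p ∷ τ)))
      ≡⟨ cong (total-displacement ∘ map proj₂) (filter-reject same? e≢) ⟩
    total-displacement (map proj₂ (filter same? τ))
      ≡⟨ trans (displacement-filter u<v τ) (sym (ℤ.+-identityˡ _)) ⟩
    0ℤ ℤ.+ total-displacement (increments u v τ)
      ≡⟨ cong (ℤ._+ total-displacement (increments u v τ)) (sym (increment-∦ {u = u} {v} p λ j → e≢ (joins-edge u<v e j))) ⟩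
    total-displacement (increments u v (p ∷ τ)) ∎

module ValidStream {c n d L T : ℕ} {σ : Stream n L} (valid : Valid c n d L T σ) where

  open Valid valid
  open Triangles (n ^ c) n

  τ = toList σ

  prefix-displacement : ∀ {u v} (u<v : u Fin.< v) t →
    stateAt σ t (edge u v u<v) ≡ total-displacement (take t (increments u v τ))
  prefix-displacement {u} {v} u<v t =
    trans (displacement-filter u<v (take t τ)) (cong total-displacement (sym (take-map t τ)))

  final-displacement : ∀ {u v} (u<v : u Fin.< v) → final σ (edge u v u<v) ≡ total-displacement (increments u v τ)
  final-displacement {u} {v} u<v = trans (prefix-displacement u<v L) (cong total-displacement
    (take-all L (increments u v τ) (≤-reflexive (trans (length-map (increment u v) τ) (length-toList σ)))))

  walk-< : ∀ {u v} → u Fin.< v → Walk 0 (increments u v τ)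
  walk-< {u} {v} u<v = prefixes-Walk (n ^ c) (increments u v τ) 0 inside last
    where
    e = edge u v u<v
    inside : ∀ t → t ≤ length (increments u v τ) →
      ∃[ y ] ℤ.+ y ≡ 0ℤ ℤ.+ total-displacement (take t (increments u v τ)) × y ≤ n ^ c
    inside t t≤ = ℤ.∣ stateAt σ t e ∣ ,
      trans (ℤ.0≤i⇒+∣i∣≡i (strict t t≤L e)) (trans (prefix-displacement u<v t) (sym (ℤ.+-identityˡ _))) ,
      states-bounded t t≤L e
      where
      t≤L : t ≤ L
      t≤L = ≤-trans t≤ (≤-reflexive (trans (length-map (increment u v) τ) (length-toList σ)))
    last : ∃[ y ] ℤ.+ y ≡ 0ℤ ℤ.+ total-displacement (increments u v τ) × y ≤ 1
    last with final-0/1 e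
    ... | inj₁ eq = 0 , trans (sym eq) (trans (final-displacement u<v) (sym (ℤ.+-identityˡ _))) , z≤n
    ... | inj₂ eq = 1 , trans (sym eq) (trans (final-displacement u<v) (sym (ℤ.+-identityˡ _))) , ≤-refl

  walk-diagonal : ∀ u (τ : List (Update n)) → Walk 0 (increments u u τ)
  walk-diagonal u []      = z≤n
  walk-diagonal u (p ∷ τ) rewrite increment-∦ {u = u} {v = u} p (joins-irrefl {e = proj₁ p}) = refl , walk-diagonal u τ

  admissible : Admissible τ
  admissible u v with Fin.<-cmp u v
  ... | tri< u<v _ _  = 0 , walk-< u<v
  ... | tri≈ _ refl _ = 0 , walk-diagonal u τ
  ... | tri> _ _ v<u  = 0 , subst (Walk 0) (increments-sym v u τ) (walk-< v<u)

  born-edge : ∀ {u v} (u<v : u Fin.< v) → ∃[ y ] final σ (edge u v u<v) ≡ ℤ.+ y × born u v τ ≡ isOne y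
  born-edge {u} {v} u<v with y , eq , r ← reflected-Walk 0 (increments u v τ) (walk-< u<v) =
    y , trans (final-displacement u<v) (trans (sym (ℤ.+-identityˡ _)) (sym eq)) , r

  edgeFrom⇒born : ∀ {u v} → EdgeFrom (final σ) u v → born u v τ ≡ 1
  edgeFrom⇒born (u<v , x≡1) with y , eq , b ← born-edge u<v =
    trans b (cong isOne (ℤ.+-injective (trans (sym eq) x≡1)))

  isOne-no : ∀ {y} → y ≢ 1 → isOne y ≡ 0
  isOne-no {0}           y≢1 = refl
  isOne-no {1}           y≢1 = contradiction refl y≢1
  isOne-no {suc (suc _)} y≢1 = refl

  ¬edgeFrom⇒¬born : ∀ {u v} → u Fin.< v → ¬ EdgeFrom (final σ) u v → born u v τ ≡ 0
  ¬edgeFrom⇒¬born u<v ¬e with y , eq , b ← born-edge u<v =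
    trans b (isOne-no λ y≡1 → ¬e (u<v , trans eq (cong ℤ.+_ y≡1)))

  adj⇒born : ∀ {u v} → Adj (final σ) u v → born u v τ ≡ 1
  adj⇒born         (inj₁ e) = edgeFrom⇒born e
  adj⇒born {u} {v} (inj₂ e) = trans (born-sym u v τ) (edgeFrom⇒born e)

  ¬adj⇒¬born : ∀ {u v} → ¬ Adj (final σ) u v → born u v τ ≡ 0
  ¬adj⇒¬born {u} {v} ¬adj with Fin.<-cmp u v
  ... | tri< u<v _ _  = ¬edgeFrom⇒¬born u<v (¬adj ∘ inj₁)
  ... | tri≈ _ refl _ = born-irrefl u τ
  ... | tri> _ _ v<u  = trans (born-sym u v τ) (¬edgeFrom⇒¬born v<u (¬adj ∘ inj₂))

  born-adj : ∀ u v → indicator (adj? (final σ) u v) ≡ born u v τ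
  born-adj u v = indicator-unique (adj? (final σ) u v) adj⇒born ¬adj⇒¬born

  degree-born : ∀ u → ∑[ v < n ] born u v τ ≤ d
  degree-born u = ≤-trans (≤-reflexive (sym (trans (length-filter-tabulate (adj? (final σ) u) id)
    (sum-cong-≗ (born-adj u))))) (max-degree u)

  lt : Fin n → Fin n → ℕ
  lt u v = indicator (u Fin.<? v)

  f t : Fin n → Fin n → Fin n → ℕ
  f u v w = born u v τ * born v w τ * born u w τ
  t u v w = lt u v * lt v w * f u v w

  #triangles-t : #triangles (final σ) ≡ ∑[ u < n ] ∑[ v < n ] ∑[ w < n ] t u v w
  #triangles-t = trans (length-filter-cartesianProductWith tri? _,_ id _)
    (sum-cong-≗ λ u → trans (length-filter-cartesianProductWith (λ vw → tri? (u , vw)) _,_ id _)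
      (sum-cong-≗ λ v → trans (length-filter-tabulate (λ w → tri? (u , v , w)) id)
        (sum-cong-≗ λ w → trans
          (trans (indicator-× ((u Fin.<? v) ×-dec (v Fin.<? w)) (ad u v ×-dec (ad v w ×-dec ad u w)))
            (cong₂ _*_ (indicator-× (u Fin.<? v) (v Fin.<? w))
              (trans (indicator-× (ad u v) (ad v w ×-dec ad u w)) (cong (indicator (ad u v) *_) (indicator-× (ad v w) (ad u w))))))
          (cong (lt u v * lt v w *_)
            (trans (cong₂ _*_ (born-adj u v) (cong₂ _*_ (born-adj v w) (born-adj u w))) (sym (*-assoc (born u v τ) _ _)))))))
    where
    tri? = triangle? (final σ)
    ad = adj? (final σ)

  lt-cases : ∀ {u v} → u ≢ v → (u Fin.< v × lt u v ≡ 1 × lt v u ≡ 0) ⊎ (v Fin.< u × lt u v ≡ 0 × lt v u ≡ 1)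
  lt-cases {u} {v} u≢v with Fin.<-cmp u v
  ... | tri< u<v _ v≮u = inj₁ (u<v , indicator-yes (u Fin.<? v) u<v , indicator-no (v Fin.<? u) v≮u)
  ... | tri≈ _ u≡v _   = contradiction u≡v u≢v
  ... | tri> u≮v _ v<u = inj₂ (v<u , indicator-no (u Fin.<? v) u≮v , indicator-yes (v Fin.<? u) v<u)

  -- The summands are the indicators of the six linear orders of u, v and w.
  orders : Fin n → Fin n → Fin n → ℕ
  orders u v w = lt u v * lt v w + lt u w * lt w v + lt v u * lt u w + lt v w * lt w u + lt w u * lt u v + lt w v * lt v u

  orders≡1 : ∀ {u v w} → u ≢ v → v ≢ w → u ≢ w → orders u v w ≡ 1
  orders≡1 u≢v v≢w u≢w with lt-cases u≢v | lt-cases v≢w | lt-cases u≢w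
  ... | inj₁ (_ , p , p′) | inj₁ (_ , q , q′) | inj₁ (_ , r , r′) rewrite p | p′ | q | q′ | r | r′ = refl
  ... | inj₁ (_ , p , p′) | inj₂ (_ , q , q′) | inj₁ (_ , r , r′) rewrite p | p′ | q | q′ | r | r′ = refl
  ... | inj₁ (_ , p , p′) | inj₂ (_ , q , q′) | inj₂ (_ , r , r′) rewrite p | p′ | q | q′ | r | r′ = refl
  ... | inj₂ (_ , p , p′) | inj₁ (_ , q , q′) | inj₁ (_ , r , r′) rewrite p | p′ | q | q′ | r | r′ = refl
  ... | inj₂ (_ , p , p′) | inj₁ (_ , q , q′) | inj₂ (_ , r , r′) rewrite p | p′ | q | q′ | r | r′ = refl
  ... | inj₂ (_ , p , p′) | inj₂ (_ , q , q′) | inj₂ (_ , r , r′) rewrite p | p′ | q | q′ | r | r′ = refl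
  ... | inj₁ (u<v , _) | inj₁ (v<w , _) | inj₂ (w<u , _) = contradiction (<-trans (<-trans u<v v<w) w<u) (<-irrefl refl)
  ... | inj₂ (v<u , _) | inj₂ (w<v , _) | inj₁ (u<w , _) = contradiction (<-trans (<-trans w<v v<u) u<w) (<-irrefl refl)

  f-orders : ∀ u v w → f u v w ≡ orders u v w * f u v w
  f-orders u v w with u Fin.≟ v | v Fin.≟ w | u Fin.≟ w
  ... | no u≢v | no v≢w | no u≢w = sym (trans (cong (_* f u v w) (orders≡1 u≢v v≢w u≢w)) (*-identityˡ (f u v w)))
  ... | yes refl | _ | _ = trans zero-f (sym (trans (cong (orders u u w *_) zero-f) (*-zeroʳ (orders u u w))))
    where
    zero-f : f u u w ≡ 0
    zero-f rewrite born-irrefl u τ = refl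
  ... | no _ | yes refl | _ = trans zero-f (sym (trans (cong (orders u v v *_) zero-f) (*-zeroʳ (orders u v v))))
    where
    zero-f : f u v v ≡ 0
    zero-f rewrite born-irrefl v τ | *-zeroʳ (born u v τ) = refl
  ... | no _ | no _ | yes refl = trans zero-f (sym (trans (cong (orders u v u *_) zero-f) (*-zeroʳ (orders u v u))))
    where
    zero-f : f u v u ≡ 0
    zero-f rewrite born-irrefl u τ = *-zeroʳ (born u v τ * born v u τ)

  -- `f` vanishes on triples with a repetition, and any other triple has exactly one linear order.
  -- Since `f` is symmetric, the six orders contribute equally.
  ordered-#triangles : ordered τ ≡ 6 * #triangles (final σ)
  ordered-#triangles = begin-equality
    ∑[ u < n ] ∑[ v < n ] ∑[ w < n ] f u v w
      ≡⟨ sum-cong-≗ (λ u → sum-cong-≗ λ v → sum-cong-≗ λ w → six u v w) ⟩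
    ∑[ u < n ] ∑[ v < n ] ∑[ w < n ] (t u v w + (t u w v + (t v u w + (t v w u + (t w u v + t w v u)))))
      ≡⟨ trans (∑³-distrib-+ t _) (cong (S +_) (trans (∑³-distrib-+ (λ u v w → t u w v) _) (cong₂ _+_ (∑-swap t)
           (trans (∑³-distrib-+ (λ u v w → t v u w) _) (cong₂ _+_ (∑-comm λ u v → ∑[ w < n ] t v u w)
           (trans (∑³-distrib-+ (λ u v w → t v w u) _) (cong₂ _+_ (∑-rotate t)
           (trans (∑³-distrib-+ (λ u v w → t w u v) (λ u v w → t w v u)) (cong₂ _+_
             (trans (∑-rotate (λ u v w → t v w u)) (∑-rotate t))
             (trans (∑-rotate (λ u v w → t v u w)) (∑-comm λ u v → ∑[ w < n ] t v u w))))))))))) ⟩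
    S + (S + (S + (S + (S + S))))
      ≡⟨ sixfold S ⟩
    6 * S
      ≡⟨ cong (6 *_) (sym #triangles-t) ⟩
    6 * #triangles (final σ) ∎
    where
    open ≤-Reasoning
    S = ∑[ u < n ] ∑[ v < n ] ∑[ w < n ] t u v w
    sixfold : ∀ x → x + (x + (x + (x + (x + x)))) ≡ 6 * x
    sixfold = solve-∀
    expand : ∀ a b c a′ b′ c′ x y z →
      (a * b + c * b′ + a′ * c + b * c′ + c′ * a + b′ * a′) * (x * y * z) ≡
      a * b * (x * y * z) + (c * b′ * (z * y * x) + (a′ * c * (x * z * y) +
        (b * c′ * (y * z * x) + (c′ * a * (z * x * y) + b′ * a′ * (y * x * z)))))
    expand = solve-∀
    six : ∀ u v w → f u v w ≡ t u v w + (t u w v + (t v u w + (t v w u + (t w u v + t w v u))))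
    six u v w rewrite born-sym v u τ | born-sym w v τ | born-sym w u τ =
      trans (f-orders u v w) (expand (lt u v) (lt v w) (lt u w) (lt v u) (lt w v) (lt w u) (born u v τ) (born v w τ) (born u w τ))

  -- Unbiasedness of the sampler. The two factors 6 have different origins: one counts the roles of
  -- the first-born edge, the other the orders of the vertices.
  weighted-#triangles : weighted (λ _ _ _ → 1) τ ≡ #triangles (final σ)
  weighted-#triangles = *-cancelˡ-≡ _ _ 6 (trans (sym (ordered-weighted τ admissible)) ordered-#triangles)

-- Chebyshev's inequality

allVec : ∀ k l → List (Vec (Fin k) l)
allVec k zero    = [] ∷ []
allVec k (suc l) = cartesianProductWith _∷_ (allFin k) (allVec k l)

allVec-unique : ∀ k l → Unique (allVec k l)
allVec-unique k zero    = AllPairs._∷_ [] AllPairs.[]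
allVec-unique k (suc l) = cartesianProductWith⁺ _∷_ ∷-injective (allFin⁺ k) (allVec-unique k l)

module _ {n : ℕ} (A : Sampler n) where

  open Sampler A

  algorithm : (Memory → ℚ) → StreamingAlgorithm n
  algorithm output = record { Memory = Memory ; coins = coins ; init = init ; step = step ; output = output }

  module _ (output : Memory → ℚ) where

    open StreamingAlgorithm (algorithm output) using (run; Reachable; start; next; UsesBits)

    compact-UsesBits : ∀ {s} → Compact A s → UsesBits s
    compact-UsesBits compact = proj₁ code , λ r r′ → proj₂ code (invariant r) (invariant r′)
      where
      open Compact compact
      invariant : ∀ {x} → Reachable x → Invariant x
      invariant (start r)    = initially r
      invariant (next r p i) = preserved r p (invariant i)

    final-memory : ∀ {L} → Stream n L → Vec (Fin coins) (suc L) → Memory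
    final-memory σ (r ∷ ω) = run ω σ (init r)

    count-run : ∀ {L} (σ : Stream n L) {P : Memory → Set} (P? : Decidable P) x →
      length (filter (λ ω → P? (run ω σ x)) (allVec coins L)) ≡ total step (toList σ) (λ y → indicator (P? y)) x
    count-run []      P? x with does (P? x)
    ... | true  = refl
    ... | false = refl
    count-run {suc L} (p ∷ σ) P? x = trans (length-filter-cartesianProductWith (λ ω → P? (run ω (p ∷ σ) x)) _∷_ id (allVec coins L))
      (sum-cong-≗ λ r → count-run σ P? (step r p x))

    count-final-memory : ∀ {L} (σ : Stream n L) {P : Memory → Set} (P? : Decidable P) →
      length (filter (λ ω → P? (final-memory σ ω)) (allVec coins (suc L))) ≡ runs (toList σ) (λ y → indicator (P? y))
    count-final-memory {L} σ P? = trans (length-filter-cartesianProductWith (λ ω → P? (final-memory σ ω)) _∷_ id (allVec coins L))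
      (sum-cong-≗ λ r → count-run σ P? (init r))

    -- The event `E` concerns a Dedekind real and need not be decidable; the outcomes are counted by
    -- a decidable condition on the final memory that implies it.
    probAtLeast : ∀ {a b L} (σ : Stream n L) {P : Memory → Set} (P? : Decidable P) {E : Vec (Fin coins) (suc L) → Set} →
      (∀ ω → P (final-memory σ ω) → E ω) →
      a * outcomes (toList σ) ≤ b * runs (toList σ) (λ y → indicator (P? y)) → ProbAtLeast a b E
    probAtLeast {a} {b} {L} σ P? P⇒E bound =
      filter P?′ (allVec coins (suc L)) ,
      filter⁺ P?′ (allVec-unique coins (suc L)) ,
      All.map (λ {ω} → P⇒E ω) (All.all-filter P?′ (allVec coins (suc L))) ,
      subst₂ _≤_ (cong (λ l → a * coins ^ suc l) (length-toList σ)) (cong (b *_) (sym (count-final-memory σ P?))) bound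
      where P?′ = λ ω → P? (final-memory σ ω)

  runs-mono : ∀ σ {F G} → (∀ x → F x ≤ G x) → runs σ F ≤ runs σ G
  runs-mono σ F≤G = ∑-mono λ r → total-mono step σ F≤G (init r)

  deviation : ℕ → Memory → ℕ
  deviation μ x = ∣ value x - μ ∣

  -- The expansion of the squared deviation, with the negative term moved to the left to stay in ℕ.
  runs-deviation : ∀ {σ μ V} → Moments σ μ V →
    runs σ (λ x → deviation μ x * deviation μ x) + 2 * (outcomes σ * (μ * μ)) ≤ outcomes σ * V + outcomes σ * (μ * μ)
  runs-deviation {σ} {μ} {V} M = begin
    runs σ (λ x → deviation μ x * deviation μ x) + 2 * (N * (μ * μ))
      ≡⟨ cong (runs σ (λ x → deviation μ x * deviation μ x) +_) (trans (arith N μ)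
           (trans (cong (2 * μ *_) (sym (first))) (sym (runs-* σ (2 * μ) value)))) ⟩
    runs σ (λ x → deviation μ x * deviation μ x) + runs σ (λ x → 2 * μ * value x)
      ≡⟨ trans (sym (runs-+ σ _ _)) (runs-cong σ λ x → square (value x) μ) ⟩
    runs σ (λ x → value x * value x + μ * μ)
      ≡⟨ trans (runs-+ σ _ _) (cong (runs σ (λ x → value x * value x) +_) (runs-const σ (μ * μ))) ⟩
    runs σ (λ x → value x * value x) + N * (μ * μ)
      ≤⟨ +-monoˡ-≤ (N * (μ * μ)) second ⟩
    N * V + N * (μ * μ) ∎
    where
    open ≤-Reasoning
    open Moments M
    N = outcomes σ
    arith : ∀ N μ → 2 * (N * (μ * μ)) ≡ 2 * μ * (N * μ)
    arith = solve-∀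
    square-+ : ∀ b e → e * e + 2 * b * (b + e) ≡ (b + e) * (b + e) + b * b
    square-+ = solve-∀
    square-+′ : ∀ a e → e * e + 2 * (a + e) * a ≡ a * a + (a + e) * (a + e)
    square-+′ = solve-∀
    square : ∀ a b → ∣ a - b ∣ * ∣ a - b ∣ + 2 * b * a ≡ a * a + b * b
    square a b with ≤-total b a
    ... | inj₁ b≤a with e , refl ← m≤n⇒∃[o]m+o≡n b≤a rewrite trans (m≤n⇒∣n-m∣≡n∸m b≤a) (m+n∸m≡n b e) = square-+ b e
    ... | inj₂ a≤b with e , refl ← m≤n⇒∃[o]m+o≡n a≤b rewrite trans (m≤n⇒∣m-n∣≡n∸m a≤b) (m+n∸m≡n a e) = square-+′ a e

  -- The variance is non-negative. This is how a valid stream constrains the parameters in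
  -- `T²≤second-moment`.
  mean²≤second : ∀ {σ μ V} → Moments σ μ V → μ * μ ≤ V
  mean²≤second {σ} {μ} {V} M = *-cancelˡ-≤ N {{m^n≢0 coins (suc (length σ))}} (+-cancelʳ-≤ (N * (μ * μ)) _ _ (begin
    N * (μ * μ) + N * (μ * μ)
      ≡⟨ cong (N * (μ * μ) +_) (sym (+-identityʳ _)) ⟩
    2 * (N * (μ * μ))
      ≤⟨ m≤n+m _ (runs σ (λ x → deviation μ x * deviation μ x)) ⟩
    runs σ (λ x → deviation μ x * deviation μ x) + 2 * (N * (μ * μ))
      ≤⟨ runs-deviation M ⟩
    N * V + N * (μ * μ) ∎))
    where
    open ≤-Reasoning
    N = outcomes σ

  -- The relative accuracy is `j / D`, and the variance `V` is at most a third of the squared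
  -- tolerance. Each bad outcome contributes at least `θ * θ` to the scaled squared deviations, so
  -- at most a third of the outcomes are bad.
  chebyshev : ∀ {σ μ V} D j .{{_ : NonZero (j * μ)}} → Moments σ μ (V + μ * μ) → 3 * (D * D * V) ≤ j * μ * (j * μ) →
    2 * outcomes σ ≤ 3 * runs σ (λ x → indicator (D * deviation μ x ≤? j * μ))
  chebyshev {σ} {μ} {V} D j M large = *-cancelˡ-≤ (θ * θ) {{m*n≢0 θ θ}} (+-cancelʳ-≤ (θ * θ * N) _ _ (begin
    θ * θ * (2 * N) + θ * θ * N
      ≡⟨ arith₁ (θ * θ) N ⟩
    3 * (N * (θ * θ))
      ≡⟨ cong (3 *_) (sym (runs-const σ (θ * θ))) ⟩
    3 * runs σ (λ _ → θ * θ)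
      ≤⟨ *-monoʳ-≤ 3 (runs-mono σ markov) ⟩
    3 * runs σ (λ x → θ * θ * good x + D * D * (deviation μ x * deviation μ x))
      ≡⟨ cong (3 *_) (trans (runs-+ σ _ _) (cong₂ _+_ (runs-* σ (θ * θ) good) (runs-* σ (D * D) _))) ⟩
    3 * (θ * θ * runs σ good + D * D * runs σ (λ x → deviation μ x * deviation μ x))
      ≤⟨ *-monoʳ-≤ 3 (+-monoʳ-≤ (θ * θ * runs σ good) (*-monoʳ-≤ (D * D) variance)) ⟩
    3 * (θ * θ * runs σ good + D * D * (N * V))
      ≡⟨ arith₂ (θ * θ) (runs σ good) (D * D) N V ⟩
    θ * θ * (3 * runs σ good) + 3 * (D * D * V) * N
      ≤⟨ +-monoʳ-≤ (θ * θ * (3 * runs σ good)) (*-monoˡ-≤ N large) ⟩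
    θ * θ * (3 * runs σ good) + θ * θ * N ∎))
    where
    open ≤-Reasoning
    N = outcomes σ
    θ = j * μ
    good : Memory → ℕ
    good x = indicator (D * deviation μ x ≤? θ)
    arith₁ : ∀ t N → t * (2 * N) + t * N ≡ 3 * (N * t)
    arith₁ = solve-∀
    arith₂ : ∀ t G D N V → 3 * (t * G + D * (N * V)) ≡ t * (3 * G) + 3 * (D * V) * N
    arith₂ = solve-∀
    arith₃ : ∀ N V m → N * (V + m) + N * m ≡ N * V + 2 * (N * m)
    arith₃ = solve-∀
    arith₄ : ∀ D e → D * e * (D * e) ≡ D * D * (e * e)
    arith₄ = solve-∀
    variance : runs σ (λ x → deviation μ x * deviation μ x) ≤ N * V
    variance = +-cancelʳ-≤ (2 * (N * (μ * μ))) _ _ (≤-trans (runs-deviation M) (≤-reflexive (arith₃ N V (μ * μ))))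
    by-cases : ∀ e (P? : Dec (D * e ≤ θ)) → θ * θ ≤ θ * θ * indicator P? + D * D * (e * e)
    by-cases e (yes _) = ≤-trans (≤-reflexive (sym (*-identityʳ (θ * θ)))) (m≤m+n _ _)
    by-cases e (no θ<) = ≤-trans (*-mono-≤ (<⇒≤ (≰⇒> θ<)) (<⇒≤ (≰⇒> θ<)))
      (≤-trans (≤-reflexive (arith₄ D e)) (m≤n+m _ (θ * θ * 0)))
    markov : ∀ x → θ * θ ≤ θ * θ * good x + D * D * (deviation μ x * deviation μ x)
    markov x = by-cases (deviation μ x) (D * deviation μ x ≤? θ)

-- Rational estimates

toℚᵘ-fromℕ : ∀ m → toℚᵘ (fromℕ m) ℚᵘ.≃ mkℚᵘ (ℤ.+ m) 0
toℚᵘ-fromℕ m = ℚ.toℚᵘ-fromℚᵘ (mkℚᵘ (ℤ.+ m) 0)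

fromℕ-+ : ∀ a b → fromℕ (a + b) ≡ fromℕ a ℚ.+ fromℕ b
fromℕ-+ a b = ℚ.toℚᵘ-injective (ℚᵘ.≃-trans (toℚᵘ-fromℕ (a + b)) (ℚᵘ.≃-trans
  (*≡* (cong₂ ℤ._*_ (sym (cong₂ ℤ._+_ (ℤ.*-identityʳ (ℤ.+ a)) (ℤ.*-identityʳ (ℤ.+ b)))) refl))
  (ℚᵘ.≃-sym (ℚᵘ.≃-trans (ℚ.toℚᵘ-homo-+ (fromℕ a) (fromℕ b)) (ℚᵘ.+-cong (toℚᵘ-fromℕ a) (toℚᵘ-fromℕ b))))))

fromℕ-* : ∀ a b → fromℕ (a * b) ≡ fromℕ a ℚ.* fromℕ b
fromℕ-* a b = ℚ.toℚᵘ-injective (ℚᵘ.≃-trans (toℚᵘ-fromℕ (a * b)) (ℚᵘ.≃-trans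
  (*≡* (cong (ℤ._* ℤ.1ℤ) (ℤ.pos-* a b)))
  (ℚᵘ.≃-sym (ℚᵘ.≃-trans (ℚ.toℚᵘ-homo-* (fromℕ a) (fromℕ b)) (ℚᵘ.*-cong (toℚᵘ-fromℕ a) (toℚᵘ-fromℕ b))))))

fromℕ-mono-≤ : ∀ {a b} → a ≤ b → fromℕ a ℚ.≤ fromℕ b
fromℕ-mono-≤ {a} {b} a≤b = ℚ.toℚᵘ-cancel-≤ (ℚᵘ.≤-respˡ-≃ (ℚᵘ.≃-sym (toℚᵘ-fromℕ a))
  (ℚᵘ.≤-respʳ-≃ (ℚᵘ.≃-sym (toℚᵘ-fromℕ b)) (*≤* (ℤ.*-monoʳ-≤-nonNeg ℤ.1ℤ (ℤ.+≤+ a≤b)))))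

fromℕ-mono-< : ∀ {a b} → a < b → fromℕ a ℚ.< fromℕ b
fromℕ-mono-< {a} {b} a<b = ℚ.toℚᵘ-cancel-< (ℚᵘ.<-respˡ-≃ (ℚᵘ.≃-sym (toℚᵘ-fromℕ a))
  (ℚᵘ.<-respʳ-≃ (ℚᵘ.≃-sym (toℚᵘ-fromℕ b)) (ℚᵘ.*<* (ℤ.*-monoʳ-<-pos ℤ.1ℤ (ℤ.+<+ a<b)))))

instance
  fromℕ-pos : ∀ {m} .{{_ : NonZero m}} → ℚ.Positive (fromℕ m)
  fromℕ-pos {m} = ℚ.normalize-pos m 1

fromℕ-nonNeg : ∀ m → ℚ.NonNegative (fromℕ m)
fromℕ-nonNeg m = ℚ.normalize-nonNeg m 1

/-*-cancel : ∀ i d .{{_ : NonZero d}} → (i ℚ./ d) ℚ.* fromℕ d ≡ i ℚ./ 1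
/-*-cancel i d@(suc d-1) = ℚ.toℚᵘ-injective (ℚᵘ.≃-trans (ℚ.toℚᵘ-homo-* (i ℚ./ d) (fromℕ d))
  (ℚᵘ.≃-trans (ℚᵘ.*-cong (ℚ.toℚᵘ-fromℚᵘ (mkℚᵘ i d-1)) (toℚᵘ-fromℕ d))
  (ℚᵘ.≃-trans (*≡* (trans (ℤ.*-identityʳ (i ℤ.* ℤ.+ d)) (cong (λ x → i ℤ.* ℤ.+ x) (sym (*-identityʳ d)))))
    (ℚᵘ.≃-sym (ℚ.toℚᵘ-fromℚᵘ (mkℚᵘ i 0))))))

-- `S` is the sum of `k` copies, compared with its mean `k * μ`, and `j / D` is the accuracy
-- reached. Both inequalities are proved after multiplication by `D * k`.
approximates : ∀ S k μ D j q .{{_ : NonZero k}} .{{_ : NonZero D}} →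
  D * ∣ S - k * μ ∣ ≤ j * (k * μ) → fromℕ j ℚ.≤ q ℚ.* fromℕ D →
  (1ℚ ℚ.- q) ℚ.* fromℕ μ ℚ.≤ ℤ.+ S ℚ./ k × ℤ.+ S ℚ./ k ℚ.≤ (1ℚ ℚ.+ q) ℚ.* fromℕ μ
approximates S k μ D j q close j≤qD =
  ℚ.*-cancelʳ-≤-pos (δ ℚ.* κ) {{δκ-pos}} lower , ℚ.*-cancelʳ-≤-pos (δ ℚ.* κ) {{δκ-pos}} upper
  where
  open +-*-Solver
  open ℚ.≤-Reasoning
  δ = fromℕ D
  κ = fromℕ k
  m = fromℕ μ
  X = ℤ.+ S ℚ./ k
  δκ-pos : ℚ.Positive (δ ℚ.* κ)
  δκ-pos = ℚ.pos*pos⇒pos δ κ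
  κm-nonNeg : ℚ.NonNegative (κ ℚ.* m)
  κm-nonNeg = subst ℚ.NonNegative (fromℕ-* k μ) (fromℕ-nonNeg (k * μ))
  error : fromℕ j ℚ.* (κ ℚ.* m) ℚ.≤ (q ℚ.* δ) ℚ.* (κ ℚ.* m)
  error = ℚ.*-monoʳ-≤-nonNeg (κ ℚ.* m) {{κm-nonNeg}} j≤qD
  cast : ∀ a b → fromℕ (a * b + j * (k * μ)) ≡ fromℕ a ℚ.* fromℕ b ℚ.+ fromℕ j ℚ.* (κ ℚ.* m)
  cast a b = trans (fromℕ-+ (a * b) _) (cong₂ ℚ._+_ (fromℕ-* a b)
    (trans (fromℕ-* j (k * μ)) (cong (fromℕ j ℚ.*_) (fromℕ-* k μ))))
  below : D * (k * μ) ≤ D * S + j * (k * μ)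
  below = ≤-trans (*-monoʳ-≤ D (m≤n+∣n-m∣ (k * μ) S)) (≤-trans (≤-reflexive (*-distribˡ-+ D S _)) (+-monoʳ-≤ (D * S) close))
  above : D * S ≤ D * (k * μ) + j * (k * μ)
  above = ≤-trans (*-monoʳ-≤ D (m≤n+∣m-n∣ S (k * μ))) (≤-trans (≤-reflexive (*-distribˡ-+ D (k * μ) _)) (+-monoʳ-≤ (D * (k * μ)) close))
  scale : δ ℚ.* fromℕ S ≡ X ℚ.* (δ ℚ.* κ)
  scale = trans (cong (δ ℚ.*_) (sym (/-*-cancel (ℤ.+ S) k)))
    (solve 3 (λ δ X κ → δ :* (X :* κ) := X :* (δ :* κ)) refl δ X κ)
  lower : (1ℚ ℚ.- q) ℚ.* m ℚ.* (δ ℚ.* κ) ℚ.≤ X ℚ.* (δ ℚ.* κ)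
  lower = begin
    (1ℚ ℚ.- q) ℚ.* m ℚ.* (δ ℚ.* κ)
      ≡⟨ solve 4 (λ q m δ κ → (con 1ℚ :- q) :* m :* (δ :* κ) := δ :* (κ :* m) :- q :* δ :* (κ :* m)) refl q m δ κ ⟩
    δ ℚ.* (κ ℚ.* m) ℚ.- q ℚ.* δ ℚ.* (κ ℚ.* m)
      ≡⟨ cong (ℚ._- q ℚ.* δ ℚ.* (κ ℚ.* m)) (sym (trans (fromℕ-* D (k * μ)) (cong (δ ℚ.*_) (fromℕ-* k μ)))) ⟩
    fromℕ (D * (k * μ)) ℚ.- q ℚ.* δ ℚ.* (κ ℚ.* m)
      ≤⟨ ℚ.+-monoˡ-≤ (ℚ.- (q ℚ.* δ ℚ.* (κ ℚ.* m))) (fromℕ-mono-≤ below) ⟩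
    fromℕ (D * S + j * (k * μ)) ℚ.- q ℚ.* δ ℚ.* (κ ℚ.* m)
      ≡⟨ cong (ℚ._- q ℚ.* δ ℚ.* (κ ℚ.* m)) (cast D S) ⟩
    (δ ℚ.* fromℕ S ℚ.+ fromℕ j ℚ.* (κ ℚ.* m)) ℚ.- q ℚ.* δ ℚ.* (κ ℚ.* m)
      ≤⟨ ℚ.+-monoˡ-≤ (ℚ.- (q ℚ.* δ ℚ.* (κ ℚ.* m))) (ℚ.+-monoʳ-≤ (δ ℚ.* fromℕ S) error) ⟩
    (δ ℚ.* fromℕ S ℚ.+ q ℚ.* δ ℚ.* (κ ℚ.* m)) ℚ.- q ℚ.* δ ℚ.* (κ ℚ.* m)
      ≡⟨ solve 2 (λ a b → (a :+ b) :- b := a) refl (δ ℚ.* fromℕ S) (q ℚ.* δ ℚ.* (κ ℚ.* m)) ⟩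
    δ ℚ.* fromℕ S
      ≡⟨ scale ⟩
    X ℚ.* (δ ℚ.* κ) ∎
  upper : X ℚ.* (δ ℚ.* κ) ℚ.≤ (1ℚ ℚ.+ q) ℚ.* m ℚ.* (δ ℚ.* κ)
  upper = begin
    X ℚ.* (δ ℚ.* κ)
      ≡⟨ trans (sym scale) (sym (fromℕ-* D S)) ⟩
    fromℕ (D * S)
      ≤⟨ fromℕ-mono-≤ above ⟩
    fromℕ (D * (k * μ) + j * (k * μ))
      ≡⟨ trans (cast D (k * μ)) (cong (λ x → δ ℚ.* x ℚ.+ fromℕ j ℚ.* (κ ℚ.* m)) (fromℕ-* k μ)) ⟩
    δ ℚ.* (κ ℚ.* m) ℚ.+ fromℕ j ℚ.* (κ ℚ.* m)
      ≤⟨ ℚ.+-monoʳ-≤ (δ ℚ.* (κ ℚ.* m)) error ⟩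
    δ ℚ.* (κ ℚ.* m) ℚ.+ q ℚ.* δ ℚ.* (κ ℚ.* m)
      ≡⟨ solve 4 (λ q m δ κ → δ :* (κ :* m) :+ q :* δ :* (κ :* m) := (con 1ℚ :+ q) :* m :* (δ :* κ)) refl q m δ κ ⟩
    (1ℚ ℚ.+ q) ℚ.* m ℚ.* (δ ℚ.* κ) ∎

-- All rationals below ε are at most `x / D`, and for this single rational the bound is an
-- inequality in ℕ.
space-bound : ∀ s R t x D q .{{_ : NonZero D}} → 0ℚ ℚ.< q → q ℚ.* fromℕ D ℚ.≤ fromℕ x →
  s * (x * x * t) ≤ R * (D * D) → fromℕ s ℚ.* (q ℚ.* q ℚ.* fromℕ t) ℚ.≤ fromℕ R
space-bound s R t x D q 0<q qD≤x bound = ℚ.*-cancelʳ-≤-pos (δ ℚ.* δ) {{ℚ.pos*pos⇒pos δ δ}} (begin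
  fromℕ s ℚ.* (q ℚ.* q ℚ.* fromℕ t) ℚ.* (δ ℚ.* δ)
    ≡⟨ solve 4 (λ s q t δ → s :* (q :* q :* t) :* (δ :* δ) := q :* δ :* (q :* δ) :* (s :* t)) refl (fromℕ s) q (fromℕ t) δ ⟩
  q ℚ.* δ ℚ.* (q ℚ.* δ) ℚ.* (fromℕ s ℚ.* fromℕ t)
    ≤⟨ ℚ.*-monoʳ-≤-nonNeg (fromℕ s ℚ.* fromℕ t) {{st-nonNeg}} (ℚ.≤-trans
         (ℚ.*-monoʳ-≤-nonNeg (q ℚ.* δ) {{qδ-nonNeg}} qD≤x) (ℚ.*-monoˡ-≤-nonNeg (fromℕ x) {{fromℕ-nonNeg x}} qD≤x)) ⟩
  fromℕ x ℚ.* fromℕ x ℚ.* (fromℕ s ℚ.* fromℕ t)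
    ≡⟨ solve 3 (λ x s t → x :* x :* (s :* t) := s :* (x :* x :* t)) refl (fromℕ x) (fromℕ s) (fromℕ t) ⟩
  fromℕ s ℚ.* (fromℕ x ℚ.* fromℕ x ℚ.* fromℕ t)
    ≡⟨ sym (trans (fromℕ-* s _) (cong (fromℕ s ℚ.*_) (trans (fromℕ-* (x * x) t) (cong (ℚ._* fromℕ t) (fromℕ-* x x))))) ⟩
  fromℕ (s * (x * x * t))
    ≤⟨ fromℕ-mono-≤ bound ⟩
  fromℕ (R * (D * D))
    ≡⟨ trans (fromℕ-* R (D * D)) (cong (fromℕ R ℚ.*_) (fromℕ-* D D)) ⟩
  fromℕ R ℚ.* (δ ℚ.* δ) ∎)
  where
  open +-*-Solver
  open ℚ.≤-Reasoning
  δ = fromℕ D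
  st-nonNeg : ℚ.NonNegative (fromℕ s ℚ.* fromℕ t)
  st-nonNeg = subst ℚ.NonNegative (fromℕ-* s t) (fromℕ-nonNeg (s * t))
  qδ-nonNeg : ℚ.NonNegative (q ℚ.* δ)
  qδ-nonNeg = ℚ.pos⇒nonNeg (q ℚ.* δ) {{ℚ.pos*pos⇒pos q {{ℚ.positive 0<q}} δ}}

numerator : ∀ r .{{_ : ℚ.Positive r}} → ∃[ a ] r ≡ ℤ.+ suc a ℚ./ ℚ.↧ₙ r
numerator r@(ℚ.mkℚ (ℤ.+ suc a) _ _) = a , sym (ℚ.↥p/↧p≡p r)

-- Rational approximation of a Dedekind real

module _ (ε : ℝ) where

  open ℝ ε

  cuts-< : ∀ {p q} → p <ℝ ε → ε ℝ< q → p ℚ.< q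
  cuts-< {p} {q} p<ε ε<q with ℚ.<-cmp p q
  ... | tri< p<q _ _  = p<q
  ... | tri≈ _ refl _ = contradiction (p<ε , ε<q) disjoint
  ... | tri> _ _ q<p  = contradiction (lower-closed q<p p<ε , ε<q) disjoint

  -- That is, j / D < ε < 2 j / D.
  record RationalApproximation : Set where
    field
      D j     : ℕ
      {{D≢0}} : NonZero D
      2≤j     : 2 ≤ j
      j≤D     : j ≤ D
      below   : ∀ q → ε ℝ< q → fromℕ j ℚ.≤ q ℚ.* fromℕ D
      above   : ∀ q → q <ℝ ε → q ℚ.* fromℕ D ℚ.≤ fromℕ (2 * j)

  /-mono-< : ∀ {i j} D .{{_ : NonZero D}} → i < j → (ℤ.+ i ℚ./ D) ℚ.< (ℤ.+ j ℚ./ D)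
  /-mono-< {i} {j} D i<j = ℚ.*-cancelʳ-<-nonNeg (fromℕ D) {{fromℕ-nonNeg D}}
    (subst₂ ℚ._<_ (sym (/-*-cancel (ℤ.+ i) D)) (sym (/-*-cancel (ℤ.+ j) D)) (fromℕ-mono-< i<j))

  1≡n/n : ∀ D .{{_ : NonZero D}} → 1ℚ ≡ ℤ.+ D ℚ./ D
  1≡n/n D = ℚ.≤-antisym (cancel (ℚ.≤-reflexive eq)) (cancel (ℚ.≤-reflexive (sym eq)))
    where
    cancel : ∀ {p q} → p ℚ.* fromℕ D ℚ.≤ q ℚ.* fromℕ D → p ℚ.≤ q
    cancel = ℚ.*-cancelʳ-≤-pos (fromℕ D)
    eq : 1ℚ ℚ.* fromℕ D ≡ (ℤ.+ D ℚ./ D) ℚ.* fromℕ D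
    eq = trans (ℚ.*-identityˡ (fromℕ D)) (sym (/-*-cancel (ℤ.+ D) D))

  -- A Dedekind real cannot be compared with a single rational, but `located` chooses between two.
  -- The search thus stops with ε below (j + 2) / D, which is at most 2 j / D as `2 ≤ j`. If the
  -- fuel runs out, j / D is 1, against ε < 1.
  search : ∀ D {{D≢0 : NonZero D}} → ε ℝ< 1ℚ → ∀ fuel j → j + fuel ≡ D → 2 ≤ j → (ℤ.+ j ℚ./ D) <ℝ ε → RationalApproximation
  search D ε<1 zero j eq 2≤j j<ε = contradiction
    (subst (λ i → (ℤ.+ i ℚ./ D) <ℝ ε) (trans (sym (+-identityʳ j)) eq) j<ε , subst (ε ℝ<_) (1≡n/n D) ε<1) disjoint
  search D ε<1 (suc fuel) j eq 2≤j j<ε with located (/-mono-< D (n<1+n (suc j)))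
  ... | inj₁ j+1<ε = search D ε<1 fuel (suc j) (trans (sym (+-suc j fuel)) eq) (m≤n⇒m≤1+n 2≤j) j+1<ε
  ... | inj₂ ε<j+2 = record
    { D = D ; j = j ; 2≤j = 2≤j ; j≤D = ≤-trans (m≤m+n j (suc fuel)) (≤-reflexive eq)
    ; below = λ q ε<q → subst (ℚ._≤ q ℚ.* fromℕ D) (/-*-cancel (ℤ.+ j) D)
        (ℚ.*-monoʳ-≤-nonNeg (fromℕ D) {{fromℕ-nonNeg D}} (ℚ.<⇒≤ (cuts-< j<ε ε<q)))
    ; above = λ q q<ε → ℚ.≤-trans (subst (q ℚ.* fromℕ D ℚ.≤_) (/-*-cancel (ℤ.+ (2 + j)) D)
        (ℚ.*-monoʳ-≤-nonNeg (fromℕ D) {{fromℕ-nonNeg D}} (ℚ.<⇒≤ (cuts-< q<ε ε<j+2))))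
        (fromℕ-mono-≤ (≤-trans (+-monoˡ-≤ j 2≤j) (≤-reflexive (cong (j +_) (sym (+-identityʳ j))))))
    }

  approximate : 0ℚ <ℝ ε → ε ℝ< 1ℚ → RationalApproximation
  approximate 0<ε ε<1 with r , 0<r , r<ε ← lower-open 0<ε = search D ε<1 (D ∸ 2) 2 (m+[n∸m]≡n 2≤D) ≤-refl (lower-closed small r<ε)
    where
    d = ℚ.↧ₙ r
    -- The lower bound r is at least 1 / d = 3 / D, which leaves room for the initial grid point 2 /
    -- D strictly below it.
    D = 3 * d
    instance
      D≢0 : NonZero D
      D≢0 = m*n≢0 3 d
    2≤D : 2 ≤ D
    2≤D = ≤-trans (n≤1+n 2) (m≤m*n 3 d)
    a = proj₁ (numerator r {{ℚ.positive 0<r}})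
    rD : fromℕ (3 * suc a) ≡ r ℚ.* fromℕ D
    rD = begin
      fromℕ (3 * suc a)
        ≡⟨ fromℕ-* 3 (suc a) ⟩
      fromℕ 3 ℚ.* fromℕ (suc a)
        ≡⟨ cong (fromℕ 3 ℚ.*_) (sym (/-*-cancel (ℤ.+ suc a) d)) ⟩
      fromℕ 3 ℚ.* ((ℤ.+ suc a ℚ./ d) ℚ.* fromℕ d)
        ≡⟨ cong (λ x → fromℕ 3 ℚ.* (x ℚ.* fromℕ d)) (sym (proj₂ (numerator r {{ℚ.positive 0<r}}))) ⟩
      fromℕ 3 ℚ.* (r ℚ.* fromℕ d)
        ≡⟨ solve 3 (λ x r d → x :* (r :* d) := r :* (x :* d)) refl (fromℕ 3) r (fromℕ d) ⟩
      r ℚ.* (fromℕ 3 ℚ.* fromℕ d)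
        ≡⟨ cong (r ℚ.*_) (sym (fromℕ-* 3 d)) ⟩
      r ℚ.* fromℕ D ∎
      where
      open ≡-Reasoning
      open +-*-Solver
    small : (ℤ.+ 2 ℚ./ D) ℚ.< r
    small = ℚ.*-cancelʳ-<-nonNeg (fromℕ D) {{fromℕ-nonNeg D}}
      (subst₂ ℚ._<_ (sym (/-*-cancel (ℤ.+ 2) D)) rD (fromℕ-mono-< {2} {3 * suc a} (m≤m*n 3 (suc a))))

-- The algorithms

n<2^[1+⌊log₂n⌋] : ∀ n → n < 2 ^ suc ⌊log₂ n ⌋
n<2^[1+⌊log₂n⌋] n with n <? 2 ^ suc ⌊log₂ n ⌋
... | yes n< = n<
... | no  n≮ = contradiction
  (≤-trans (≤-reflexive (sym (⌊log₂[2^n]⌋≡n (suc ⌊log₂ n ⌋)))) (⌊log₂⌋-mono-≤ (≮⇒≥ n≮))) 1+n≰n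

0<⌊log₂n⌋ : ∀ {n} → 2 ≤ n → 0 < ⌊log₂ n ⌋
0<⌊log₂n⌋ 2≤n = ⌊log₂⌋-mono-≤ 2≤n

-- For 2 ≤ n the rounded logarithm is at least 1, so doubling it makes up for the rounding.
n≤2^[2*⌊log₂n⌋] : ∀ {n} → 2 ≤ n → n ≤ 2 ^ (2 * ⌊log₂ n ⌋)
n≤2^[2*⌊log₂n⌋] {n} 2≤n = ≤-trans (<⇒≤ (n<2^[1+⌊log₂n⌋] n))
  (^-monoʳ-≤ 2 (≤-trans (+-monoˡ-≤ ⌊log₂ n ⌋ (0<⌊log₂n⌋ 2≤n)) (≤-reflexive (cong (⌊log₂ n ⌋ +_) (sym (+-identityʳ ⌊log₂ n ⌋))))))

n^k≤2^ : ∀ {n a} k → n ≤ 2 ^ a → n ^ k ≤ 2 ^ (a * k)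
n^k≤2^ {n} {a} k n≤ = ≤-trans (^-monoˡ-≤ k n≤) (≤-reflexive (^-*-assoc 2 a k))

n^k<2^ : ∀ {n a} k → n ≤ 2 ^ a → n ^ k < 2 ^ suc (a * k)
n^k<2^ {n} {a} k n≤ = ≤-<-trans (n^k≤2^ {a = a} k n≤) (^-monoʳ-< 2 (s≤s (s≤s z≤n)) (n<1+n (a * k)))

-- Storing the whole stream

module StoreAll (B n L : ℕ) where

  small? : (p : Update n) → Dec (ℤ.∣ proj₂ p ∣ ≤ B)
  small? p = ℤ.∣ proj₂ p ∣ ≤? B

  -- Surplus and oversized updates are dropped, so that memory stays bounded on every stream; valid
  -- streams have none.
  store : Update n → List (Update n) → List (Update n)
  store p xs with length xs <? L | small? p
  ... | yes _ | yes _ = xs ++ p ∷ []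
  ... | _     | _     = xs

  stateOf : List (Update n) → State n
  stateOf xs e = foldr ℤ._+_ ℤ.0ℤ (map proj₂ (filter (λ u → proj₁ u ≟ᴱ e) xs))

  storeAll : Sampler n
  storeAll = record
    { Memory = List (Update n)
    ; coins  = 1
    ; init   = λ _ → []
    ; step   = λ _ → store
    ; value  = λ xs → #triangles (stateOf xs)
    }

  Stored : List (Update n) → Set
  Stored xs = length xs ≤ L × All (λ p → ⊤ × ℤ.∣ proj₂ p ∣ ≤ B) xs

  store-stored : ∀ p xs → Stored xs → Stored (store p xs)
  store-stored p xs (l≤ , small) with length xs <? L | small? p
  ... | yes l< | yes p≤ = ≤-trans (≤-reflexive (trans (length-++ xs) (+-comm (length xs) 1))) l< , All.++⁺ small ((tt , p≤) ∷ [])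
  ... | yes _  | no _   = l≤ , small
  ... | no _   | _      = l≤ , small

  storeAll-compact : ∀ a e → n ≤ 2 ^ a → B < 2 ^ e → Compact storeAll (L * suc ((a + a) + suc (e + e)))
  storeAll-compact a e n≤ B< = record
    { Invariant = Stored
    ; initially = λ _ → z≤n , []
    ; preserved = λ _ p {xs} → store-stored p xs
    ; code      = code-List (code-× (code-Edge a n≤) (code-ℤ e B<)) L
    }

  store-++ : ∀ p xs → length xs < L → ℤ.∣ proj₂ p ∣ ≤ B → store p xs ≡ xs ++ p ∷ []
  store-++ p xs l< p≤ with length xs <? L | small? p
  ... | yes _ | yes _ = refl
  ... | no l≮ | _     = contradiction l< l≮
  ... | yes _ | no p≰ = contradiction p≤ p≰

  module _ (out : List (Update n) → ℚ) where

    open StreamingAlgorithm (algorithm storeAll out) using (run; estimate)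

    run-storeAll : ∀ {l} ω (σ : Stream n l) xs → length xs + l ≤ L → All (λ p → ℤ.∣ proj₂ p ∣ ≤ B) (toList σ) →
                   run ω σ xs ≡ xs ++ toList σ
    run-storeAll []      []      xs _ _ = sym (++-identityʳ xs)
    run-storeAll {suc l} (r ∷ ω) (p ∷ σ) xs fits (p≤ ∷ small) = begin
      run ω σ (store p xs)
        ≡⟨ cong (run ω σ) (store-++ p xs (≤-trans (s≤s (m≤m+n (length xs) l)) fits′) p≤) ⟩
      run ω σ (xs ++ p ∷ [])
        ≡⟨ run-storeAll ω σ (xs ++ p ∷ []) (≤-trans (≤-reflexive (cong (_+ l) (trans (length-++ xs) (+-comm (length xs) 1)))) fits′) small ⟩
      (xs ++ p ∷ []) ++ toList σ
        ≡⟨ ++-assoc xs (p ∷ []) (toList σ) ⟩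
      xs ++ p ∷ toList σ ∎
      where
      open ≡-Reasoning
      fits′ : suc (length xs + l) ≤ L
      fits′ = ≤-trans (≤-reflexive (sym (+-suc (length xs) l))) fits

    -- `take L` is inserted because `final σ` unfolds to it, which lets `final-stateOf` hold by
    -- `refl`.
    estimate-storeAll : (σ : Stream n L) → All (λ p → ℤ.∣ proj₂ p ∣ ≤ B) (toList σ) →
                        ∀ ω → estimate σ ω ≡ out (take L (toList σ))
    estimate-storeAll σ small (r ∷ ω) = cong out
      (trans (run-storeAll ω σ [] ≤-refl small) (sym (take-all L (toList σ) (≤-reflexive (length-toList σ)))))

  final-stateOf : (σ : Stream n L) → final σ ≡ stateOf (take L (toList σ))
  final-stateOf σ = refl

exact : ∀ {ε n} {x y : State n} → 0ℚ <ℝ ε → x ≡ y → Approximates ε (#triangles x) (fromℕ (#triangles y))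
exact {ε} {x = x} 0<ε refl q ε<q = approximates μ 1 μ 1 0 q
  (≤-reflexive (trans (+-identityʳ _) (trans (cong (λ x → ∣ μ - x ∣) (+-identityʳ μ)) (∣n-n∣≡0 μ))))
  (ℚ.≤-trans (ℚ.<⇒≤ (cuts-< ε 0<ε ε<q)) (ℚ.≤-reflexive (sym (ℚ.*-identityʳ q))))
  where μ = #triangles x

-- Parameters, space and correctness of the algorithms

module _ (c C n d L T : ℕ) (ε : ℝ) where

  Solution : Set₁
  Solution = Σ[ A ∈ StreamingAlgorithm n ] Σ[ s ∈ ℕ ]
    StreamingAlgorithm.UsesBits A s
    × SpaceBound C n d L T ε s
    × (∀ (σ : Stream n L) → Valid c n d L T σ →
        ProbAtLeast 2 3 (λ ω → Approximates ε (#triangles (final σ)) (StreamingAlgorithm.estimate A σ ω)))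

  below-one : ε ℝ< 1ℚ → ∀ q → q <ℝ ε → q ℚ.* fromℕ 1 ℚ.≤ fromℕ 1
  below-one ε<1 q q<ε = ℚ.≤-trans (ℚ.≤-reflexive (ℚ.*-identityʳ q)) (ℚ.<⇒≤ (cuts-< ε q<ε ε<1))

  vacuous : ε ℝ< 1ℚ → (∀ σ → ¬ Valid c n d L T σ) → Solution
  vacuous ε<1 invalid = algorithm idle (λ _ → 0ℚ) , 0 , compact-UsesBits idle (λ _ → 0ℚ) idle-compact ,
    (λ q 0<q q<ε → space-bound 0 (C * (d ^ 3 * L ^ 2) * ⌊log₂ n ⌋) (T ^ 2) 1 1 q 0<q (below-one ε<1 q q<ε) z≤n) ,
    (λ σ valid → contradiction valid (invalid σ))
    where
    idle : Sampler n
    idle = record { Memory = ⊤ ; coins = 1 ; init = λ _ → tt ; step = λ _ _ _ → tt ; value = λ _ → 0 }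
    idle-compact : Compact idle 0
    idle-compact = record { Invariant = λ _ → ⊤ ; initially = λ _ → tt ; preserved = λ _ _ _ → tt ; code = code-⊤ }

  -- Storing takes O(L log n) bits. If T² ≤ L, then L ≤ L² / T², and the remaining factor d³ / ε² is
  -- at least 1.
  by-storing : 0ℚ <ℝ ε → ε ℝ< 1ℚ → 2 ≤ n → 1 ≤ d → T * T ≤ L → 8 + 4 * c ≤ C → Solution
  by-storing 0<ε ε<1 2≤n 1≤d T²≤L 8+4c≤C =
    algorithm storeAll out , s , compact-UsesBits storeAll out (storeAll-compact a e n≤ (n^k<2^ {a = a} c n≤)) ,
    (λ q 0<q q<ε → space-bound s (C * (d ^ 3 * L ^ 2) * ℓ) (T ^ 2) 1 1 q 0<q (below-one ε<1 q q<ε) bound) ,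
    -- `storeAll` is deterministic: with one coin face there is a single outcome.
    (λ σ valid → Vec.replicate (suc L) zero ∷ [] , AllPairs._∷_ [] AllPairs.[] ,
      subst (Approximates ε (#triangles (final σ)))
        (sym (estimate-storeAll out σ (Valid.updates-bounded valid) (Vec.replicate (suc L) zero)))
        (exact {ε} 0<ε (final-stateOf σ)) ∷ [] ,
      ≤-trans (≤-reflexive (cong (2 *_) (^-zeroˡ (suc L)))) (n≤1+n 2))
    where
    open StoreAll (n ^ c) n L
    open ≤-Reasoning
    out : List (Update n) → ℚ
    out xs = fromℕ (#triangles (stateOf xs))
    ℓ = ⌊log₂ n ⌋
    a = 2 * ℓ
    e = suc (a * c)
    n≤ = n≤2^[2*⌊log₂n⌋] 2≤n
    s = L * suc ((a + a) + suc (e + e))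
    bits : ∀ ℓ c → suc ((2 * ℓ + 2 * ℓ) + suc (suc (2 * ℓ * c) + suc (2 * ℓ * c))) ≡ 4 * 1 + (4 + 4 * c) * ℓ
    bits = solve-∀
    collect : ∀ ℓ c → 4 * ℓ + (4 + 4 * c) * ℓ ≡ (8 + 4 * c) * ℓ
    collect = solve-∀
    arith₁ : ∀ L x ℓ T → L * (x * ℓ) * (1 * 1 * (T * (T * 1))) ≡ x * (1 * (1 * (1 * 1)) * (L * (T * T))) * ℓ
    arith₁ = solve-∀
    arith₂ : ∀ C D L ℓ → C * (D * (L * L)) * ℓ ≡ C * (D * (L * (L * 1))) * ℓ * (1 * 1)
    arith₂ = solve-∀
    bound : s * (1 * 1 * T ^ 2) ≤ C * (d ^ 3 * L ^ 2) * ℓ * (1 * 1)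
    bound = begin
      s * (1 * 1 * T ^ 2)
        ≤⟨ *-monoˡ-≤ (1 * 1 * T ^ 2) (*-monoʳ-≤ L (≤-trans (≤-reflexive (bits ℓ c))
             (≤-trans (+-monoˡ-≤ ((4 + 4 * c) * ℓ) (*-monoʳ-≤ 4 (0<⌊log₂n⌋ 2≤n))) (≤-reflexive (collect ℓ c))))) ⟩
      L * ((8 + 4 * c) * ℓ) * (1 * 1 * T ^ 2)
        ≡⟨ arith₁ L (8 + 4 * c) ℓ T ⟩
      (8 + 4 * c) * (1 ^ 3 * (L * (T * T))) * ℓ
        ≤⟨ *-monoˡ-≤ ℓ (*-mono-≤ 8+4c≤C (*-mono-≤ (^-monoˡ-≤ 3 1≤d) (*-monoʳ-≤ L T²≤L))) ⟩
      C * (d ^ 3 * (L * L)) * ℓ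
        ≡⟨ arith₂ C (d ^ 3) L ℓ ⟩
      C * (d ^ 3 * L ^ 2) * ℓ * (1 * 1) ∎

  by-sampling : {{L≢0 : NonZero L}} → RationalApproximation ε → 0 < T → 2 ≤ n → 1 ≤ d → T ≤ n ^ 3 → L < T * T →
    T * T ≤ 4 * (L * L * (d * d)) → 96 * (34 + 6 * c) ≤ C → Solution
  by-sampling R 0<T 2≤n 1≤d T≤n³ L<T² T²≤V bound-C =
    algorithm A out , s , compact-UsesBits A out compact ,
    (λ q 0<q q<ε → space-bound s (C * (d ^ 3 * L ^ 2) * ℓ) (T ^ 2) (2 * j) D q 0<q (above q q<ε) space) ,
    accurate
    where
    open EdgeSampling (n ^ c) n L using (sampler; sampler-moments)
    open RationalApproximation R
    open ≤-Reasoning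

    -- Chebyshev's inequality asks for X / Y copies.
    X = 12 * (L * L * (d * d) * (D * D))
    Y = j * j * (T * T)

    instance
      j≢0 : NonZero j
      j≢0 = >-nonZero (<⇒≤ 2≤j)
      T≢0 : NonZero T
      T≢0 = >-nonZero 0<T
      Y≢0 : NonZero Y
      Y≢0 = m*n≢0 (j * j) (T * T) {{m*n≢0 j j}} {{m*n≢0 T T}}

    -- The 12 in `X` is the 4 of the second moment times the 3 of the failure probability 1/3.
    -- Rounding up at most doubles the number of copies, since `T²≤V` and `j≤D` give Y ≤ X.
    k = suc (X / Y)

    X≤kY : X ≤ k * Y
    X≤kY = ≤-trans (≤-reflexive (m≡m%n+[m/n]*n X Y)) (+-monoˡ-≤ (X / Y * Y) (<⇒≤ (m%n<n X Y)))

    kY≤2X : k * Y ≤ 2 * X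
    kY≤2X = begin
      Y + X / Y * Y
        ≤⟨ +-mono-≤ (*-mono-≤ (*-mono-≤ j≤D j≤D) T²≤V) (m/n*n≤m X Y) ⟩
      D * D * (4 * (L * L * (d * d))) + X
        ≤⟨ +-monoˡ-≤ X (≤-trans (≤-reflexive (arith (D * D) (L * L * (d * d)))) (m≤m+n _ _)) ⟩
      (4 * (L * L * (d * d) * (D * D)) + 8 * (L * L * (d * d) * (D * D))) + X
        ≡⟨ cong (_+ X) (sym (*-distribʳ-+ (L * L * (d * d) * (D * D)) 4 8)) ⟩
      X + X
        ≡⟨ cong (X +_) (sym (+-identityʳ X)) ⟩
      2 * X ∎
      where
      arith : ∀ D L → D * (4 * L) ≡ 4 * (L * D)
      arith = solve-∀

    A = copies k sampler
    out : Sampler.Memory A → ℚ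
    out x = ℤ.+ Sampler.value A x ℚ./ k

    ℓ = ⌊log₂ n ⌋
    a = 2 * ℓ
    b = a * 6
    e = suc (a * c)
    bits = suc (b + (a + (a + (a + (b + (e + (e + e)))))))
    s = k * bits

    n≤ : n ≤ 2 ^ a
    n≤ = n≤2^[2*⌊log₂n⌋] 2≤n

    L<2^b : L < 2 ^ b
    L<2^b = <-≤-trans L<T² (≤-trans (*-mono-≤ T≤n³ T≤n³)
      (≤-trans (≤-reflexive (sym (^-distribˡ-+-* n 3 3))) (n^k≤2^ {a = a} 6 n≤)))

    compact : Compact A s
    compact = copies-compact k (sampler-compact (n ^ c) n L a b e n≤ L<2^b (n^k<2^ {a = a} c n≤))

    -- The two counters take 24ℓ bits, the three vertices 6ℓ, and the trackers 6cℓ besides three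
    -- single bits. With the tag of the sum type, four single bits remain, at most 4ℓ.
    bits≤ : bits ≤ (34 + 6 * c) * ℓ
    bits≤ = ≤-trans (≤-reflexive (arith₁ ℓ c))
      (≤-trans (+-monoˡ-≤ ((30 + 6 * c) * ℓ) (*-monoʳ-≤ 4 (0<⌊log₂n⌋ 2≤n))) (≤-reflexive (arith₂ ℓ c)))
      where
      arith₁ : ∀ ℓ c → suc (2 * ℓ * 6 + (2 * ℓ + (2 * ℓ + (2 * ℓ + (2 * ℓ * 6 +
        (suc (2 * ℓ * c) + (suc (2 * ℓ * c) + suc (2 * ℓ * c)))))))) ≡ 4 * 1 + (30 + 6 * c) * ℓ
      arith₁ = solve-∀
      arith₂ : ∀ ℓ c → 4 * ℓ + (30 + 6 * c) * ℓ ≡ (34 + 6 * c) * ℓ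
      arith₂ = solve-∀

    -- 96 = 4 · 2 · 12: the square of the 2 in `2 * j`, the factor of `kY≤2X`, and the constant in
    -- `X`.
    space : s * (2 * j * (2 * j) * T ^ 2) ≤ C * (d ^ 3 * L ^ 2) * ℓ * (D * D)
    space = begin
      k * bits * (2 * j * (2 * j) * T ^ 2)
        ≡⟨ arith₁ k bits j T ⟩
      4 * bits * (k * Y)
        ≤⟨ *-mono-≤ (*-monoʳ-≤ 4 bits≤) kY≤2X ⟩
      4 * ((34 + 6 * c) * ℓ) * (2 * X)
        ≡⟨ arith₂ (34 + 6 * c) ℓ L d D ⟩
      96 * (34 + 6 * c) * (1 * (d * d) * (L * L)) * ℓ * (D * D)
        ≤⟨ *-monoˡ-≤ (D * D) (*-monoˡ-≤ ℓ (*-mono-≤ bound-C (*-monoˡ-≤ (L * L) (*-monoˡ-≤ (d * d) 1≤d)))) ⟩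
      C * (d * (d * d) * (L * L)) * ℓ * (D * D)
        ≡⟨ arith₃ C d L ℓ D ⟩
      C * (d ^ 3 * L ^ 2) * ℓ * (D * D) ∎
      where
      arith₁ : ∀ k b j T → k * b * (2 * j * (2 * j) * (T * (T * 1))) ≡ 4 * b * (k * (j * j * (T * T)))
      arith₁ = solve-∀
      arith₂ : ∀ x ℓ L d D → 4 * (x * ℓ) * (2 * (12 * (L * L * (d * d) * (D * D)))) ≡
                             96 * x * (1 * (d * d) * (L * L)) * ℓ * (D * D)
      arith₂ = solve-∀
      arith₃ : ∀ C d L ℓ D → C * (d * (d * d) * (L * L)) * ℓ * (D * D) ≡
                             C * (d * (d * (d * 1)) * (L * (L * 1))) * ℓ * (D * D)
      arith₃ = solve-∀

    accurate : (σ : Stream n L) → Valid c n d L T σ → ProbAtLeast 2 3 (λ ω →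
      Approximates ε (#triangles (final σ)) (StreamingAlgorithm.estimate (algorithm A out) σ ω))
    accurate σ valid = probAtLeast A out {2} {3} σ (λ x → D * deviation A (k * μ) x ≤? j * (k * μ)) approximate-output
      (chebyshev A {V = k * V} D j {{m*n≢0 j (k * μ) {{j≢0}} {{m*n≢0 k μ}}}} (copies-moments k moments) large)
      where
      open ValidStream valid
      μ = #triangles (final σ)
      V = 4 * (L * L * (d * d))
      T≤μ : T ≤ μ
      T≤μ = Valid.many-triangles valid
      instance
        μ≢0 : NonZero μ
        μ≢0 = >-nonZero (≤-trans 0<T T≤μ)
      moments : Sampler.Moments sampler τ μ V
      moments = subst (λ x → Sampler.Moments sampler τ x V) weighted-#triangles
        (sampler-moments d τ (length-toList σ) admissible degree-born)
      large : 3 * (D * D * (k * V)) ≤ j * (k * μ) * (j * (k * μ))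
      large = begin
        3 * (D * D * (k * V))
          ≡⟨ arith₁ D k L d ⟩
        k * X
          ≤⟨ *-monoʳ-≤ k X≤kY ⟩
        k * (k * Y)
          ≤⟨ *-monoʳ-≤ k (*-monoʳ-≤ k (*-monoʳ-≤ (j * j) (*-mono-≤ T≤μ T≤μ))) ⟩
        k * (k * (j * j * (μ * μ)))
          ≡⟨ arith₂ k j μ ⟩
        j * (k * μ) * (j * (k * μ)) ∎
        where
        arith₁ : ∀ D k L d → 3 * (D * D * (k * (4 * (L * L * (d * d))))) ≡ k * (12 * (L * L * (d * d) * (D * D)))
        arith₁ = solve-∀
        arith₂ : ∀ k j μ → k * (k * (j * j * (μ * μ))) ≡ j * (k * μ) * (j * (k * μ))
        arith₂ = solve-∀
      approximate-output : ∀ ω → D * deviation A (k * μ) (final-memory A out σ ω) ≤ j * (k * μ) →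
        Approximates ε μ (StreamingAlgorithm.estimate (algorithm A out) σ ω)
      approximate-output (r ∷ ω) close q ε<q =
        approximates (Sampler.value A (final-memory A out σ (r ∷ ω))) k μ D j q close (below q ε<q)

#triangles≤n³ : ∀ {n} (x : State n) → #triangles x ≤ n ^ 3
#triangles≤n³ {n} x = begin
  #triangles x
    ≡⟨ length-filter-cartesianProductWith (triangle? x) _,_ id (cartesianProduct (allFin n) (allFin n)) ⟩
  ∑[ u < n ] length (filter (λ vw → triangle? x (u , vw)) (cartesianProduct (allFin n) (allFin n)))
    ≤⟨ ∑-mono (λ u → pairs u) ⟩
  ∑[ u < n ] (n * n)
    ≡⟨ ∑-const n (n * n) ⟩
  n * (n * n)
    ≡⟨ cong (λ m → n * (n * m)) (sym (*-identityʳ n)) ⟩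
  n ^ 3 ∎
  where
  open ≤-Reasoning
  pairs : ∀ u → length (filter (λ vw → triangle? x (u , vw)) (cartesianProduct (allFin n) (allFin n))) ≤ n * n
  pairs u = begin
    length (filter (λ vw → triangle? x (u , vw)) (cartesianProduct (allFin n) (allFin n)))
      ≡⟨ length-filter-cartesianProductWith (λ vw → triangle? x (u , vw)) _,_ id (allFin n) ⟩
    ∑[ v < n ] length (filter (λ w → triangle? x (u , v , w)) (allFin n))
      ≤⟨ ∑-mono (λ v → ≤-trans (length-filter (λ w → triangle? x (u , v , w)) (allFin n)) (≤-reflexive (length-tabulate {n = n} id))) ⟩
    ∑[ v < n ] n
      ≡⟨ ∑-const n n ⟩
    n * n ∎

2≤n : ∀ {n} → Edge n → 2 ≤ n
2≤n {suc zero}    (edge zero zero ())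
2≤n {suc (suc n)} _ = s≤s (s≤s z≤n)

module _ {c n d L T : ℕ} {σ : Stream n L} (valid : Valid c n d L T σ) where

  open ValidStream valid
  open Valid valid using (many-triangles)

  -- T is at most the mean of a single copy, whose square is at most the second moment. Parameters
  -- violating this admit no valid stream.
  T²≤second-moment : {{_ : NonZero L}} → T * T ≤ 4 * (L * L * (d * d))
  T²≤second-moment = ≤-trans (*-mono-≤ many-triangles many-triangles)
    (mean²≤second (EdgeSampling.sampler (n ^ c) n L)
      (subst (λ μ → Sampler.Moments _ τ μ _) weighted-#triangles
        (EdgeSampling.sampler-moments (n ^ c) n L d τ (length-toList σ) admissible degree-born)))

empty-#triangles : ∀ {c n d T σ} → Valid c n d 0 T σ → T ≤ 0
empty-#triangles {σ = []} valid =
  ≤-trans (Valid.many-triangles valid) (≤-reflexive (sym (ValidStream.weighted-#triangles valid)))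

0<degree : ∀ T L d → 0 < T → T * T ≤ 4 * (L * L * (d * d)) → 0 < d
0<degree T L (suc d) 0<T T²≤V = s≤s z≤n
0<degree T L zero    0<T T²≤V =
  contradiction (subst (λ x → T * T ≤ 4 * x) (*-zeroʳ (L * L)) T²≤V) (<⇒≱ (*-mono-≤ 0<T 0<T))

module _ (c C : ℕ) (large : 96 * (34 + 6 * c) ≤ C) (n d l T : ℕ) (ε : ℝ) (0<T : 0 < T) (0<ε : 0ℚ <ℝ ε) (ε<1 : ε ℝ< 1ℚ) where

  private L = suc l

  -- If one of the first three tests fails, no stream is valid; the last one chooses between storing
  -- and sampling.
  solution : Dec (2 ≤ n) → Dec (T ≤ n ^ 3) → Dec (T * T ≤ 4 * (L * L * (d * d))) → Dec (T * T ≤ L) → Solution c C n d L T ε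
  solution (no n<2) _ _ _ = vacuous c C n d L T ε ε<1 λ { ((e , _) ∷ _) _ → n<2 (2≤n e) }
  solution (yes _) (no n³<T) _ _ = vacuous c C n d L T ε ε<1 λ σ valid →
    n³<T (≤-trans (Valid.many-triangles valid) (#triangles≤n³ (final σ)))
  solution (yes _) (yes _) (no V<T²) _ = vacuous c C n d L T ε ε<1 λ σ valid → V<T² (T²≤second-moment valid)
  solution (yes 2≤n) (yes _) (yes T²≤V) (yes T²≤L) =
    by-storing c C n d L T ε 0<ε ε<1 2≤n (0<degree T L d 0<T T²≤V) T²≤L (≤-trans 8+4c≤ large)
    where
    8+4c≤ : 8 + 4 * c ≤ 96 * (34 + 6 * c)
    8+4c≤ = ≤-trans (+-mono-≤ {8} {34} (m≤m+n 8 26) (*-monoˡ-≤ c {4} {6} (m≤m+n 4 2))) (m≤n*m (34 + 6 * c) 96)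
  solution (yes 2≤n) (yes T≤n³) (yes T²≤V) (no L<T²) =
    by-sampling c C n d L T ε (approximate ε 0<ε ε<1) 0<T 2≤n (0<degree T L d 0<T T²≤V) T≤n³ (≰⇒> L<T²) T²≤V large

solve : ∀ c C → 96 * (34 + 6 * c) ≤ C → ∀ n d L T ε → 0 < T → 0ℚ <ℝ ε → ε ℝ< 1ℚ → Solution c C n d L T ε
solve c C large n d zero T ε 0<T 0<ε ε<1 =
  vacuous c C n d zero T ε ε<1 λ σ valid → contradiction (empty-#triangles valid) (<⇒≱ 0<T)
solve c C large n d L@(suc l) T ε 0<T 0<ε ε<1 = solution c C large n d l T ε 0<T 0<ε ε<1
  (2 ≤? n) (T ≤? n ^ 3) (T * T ≤? 4 * (L * L * (d * d))) (T * T ≤? L)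

theorem11 : ∀ (c : ℕ) → ∃[ C ]
    (∀ (n d L T : ℕ) (ε : ℝ) → 0 < T → 0ℚ <ℝ ε → ε ℝ< 1ℚ →
    Σ[ A ∈ StreamingAlgorithm n ] Σ[ s ∈ ℕ ]
    StreamingAlgorithm.UsesBits A s
    × SpaceBound C n d L T ε s
    × (∀ (σ : Stream n L) → Valid c n d L T σ →
    ProbAtLeast 2 3 (λ ω →
    Approximates ε (#triangles (final σ)) (StreamingAlgorithm.estimate A σ ω))))
theorem11 c = 96 * (34 + 6 * c) , solve c (96 * (34 + 6 * c)) ≤-refl
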